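{- For every integer $m\ge 2$, $$\pi_f(K_{1,m,m})=\frac{24m}{8m+5+3/(2\lceil m/2\rceil-1)}.$$
   Context: $K_{1,m,m}$ is the complete tripartite graph with parts of sizes $1,m,m$. Two edges are nonincident if they share no endpoint. A linear ordering of $V(G)$ separates a pair of nonincident edges if both endpoints of one edge precede both endpoints of the other. $\pi_t(G)$ is the minimum length of a list of linear orderings of $V(G)$ (repetitions allowed) separating every pair of nonincident edges at least $t$ times, and the fractional separation dimension is $\pi_f(G)=\liminf_{t\to\infty}\pi_t(G)/t$. -}

module Defs where

open import Data.Nat using (ℕ; zero; suc; _+_; _*_; _∸_; _<_; _≤_; _≥_; _<ᵇ_; ⌈_/2⌉)
open import Data.Nat.Properties using (_≟_)
open import Data.Fin using (Fin; toℕ)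
open import Data.Fin.Permutation using (Permutation′; _⟨$⟩ʳ_)
open import Data.Bool using (Bool; true; false; _∧_; _∨_; if_then_else_)
open import Data.List using (List; length; filter; _∷_; [])
open import Data.Product using (Σ; _×_; _,_; ∃-syntax)
open import Data.Integer using (+_)
open import Data.Rational using (ℚ; _/_; _-_; Positive) renaming (_≤_ to _≤ℚ_; _+_ to _+ℚ_)
open import Relation.Nullary using (¬_)
open import Relation.Binary.PropositionalEquality using (_≡_)

-- Vertices of K_{1,m,m}: Fin (1 + m + m).
-- Part 0 = {0}, part 1 = {1..m}, part 2 = {m+1..2m}.
part : (m : ℕ) → Fin (1 + m + m) → ℕ
part m v with toℕ v
... | zero = 0
... | suc k = if k <ᵇ m then 1 else 2

Adj : (m : ℕ) → Fin (1 + m + m) → Fin (1 + m + m) → Set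
Adj m u v = ¬ (part m u ≡ part m v)

-- a linear ordering of V: a permutation giving each vertex its position
LinOrd : ℕ → Set
LinOrd n = Permutation′ n

pos : {n : ℕ} → LinOrd n → Fin n → ℕ
pos σ v = toℕ (σ ⟨$⟩ʳ v)

precedes : {n : ℕ} → LinOrd n → (a b c d : Fin n) → Bool
precedes σ a b c d =
  (pos σ a <ᵇ pos σ c) ∧ (pos σ a <ᵇ pos σ d) ∧ (pos σ b <ᵇ pos σ c) ∧ (pos σ b <ᵇ pos σ d)

separates : {n : ℕ} → LinOrd n → (a b c d : Fin n) → Bool
separates σ a b c d = precedes σ a b c d ∨ precedes σ c d a b

countSep : {n : ℕ} → List (LinOrd n) → (a b c d : Fin n) → ℕ
countSep [] a b c d = 0
countSep (σ ∷ L) a b c d =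
  (if separates σ a b c d then 1 else 0) + countSep L a b c d

NonincidentPair : (m : ℕ) → (a b c d : Fin (1 + m + m)) → Set
NonincidentPair m a b c d =
  Adj m a b × Adj m c d ×
  ¬ (a ≡ c) × ¬ (a ≡ d) × ¬ (b ≡ c) × ¬ (b ≡ d)

TSeparating : (m t : ℕ) → List (LinOrd (1 + m + m)) → Set
TSeparating m t L = ∀ a b c d → NonincidentPair m a b c d → t ≤ countSep L a b c d

IsPiT : (m t k : ℕ) → Set
IsPiT m t k =
  (Σ (List (LinOrd (1 + m + m))) λ L → (length L ≡ k) × TSeparating m t L) ×
  (∀ (L : List (LinOrd (1 + m + m))) → TSeparating m t L → k ≤ length L)

-- π_f(K_{1,m,m}) = q, i.e. liminf_{t→∞} π_t/t = q (t ranging over t = s+1 ≥ 1),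
-- spelled out with rational ε: π_t is well defined for every t, eventually
-- π_t/t ≥ q - ε, and infinitely often π_t/t ≤ q + ε.
FracSepDimIs : (m : ℕ) → ℚ → Set
FracSepDimIs m q =
  (∀ s → ∃[ k ] IsPiT m (suc s) k) ×
  (∀ (ε : ℚ) → Positive ε → ∃[ N ] ∀ s → N ≤ s → ∀ k → IsPiT m (suc s) k →
       (q - ε) ≤ℚ ((+ k) / suc s)) ×
  (∀ (ε : ℚ) → Positive ε → ∀ N → ∃[ s ] (N ≤ s × ∃[ k ] (IsPiT m (suc s) k ×
       ((+ k) / suc s) ≤ℚ (q +ℚ ε))))

-- 24m / (8m + 5 + 3/(2c-1)) with c = ⌈m/2⌉, written with cleared denominator:
-- 24m(2c-1) / ((8m+5)(2c-1) + 3); the denominator is written suc (… + 2).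
targetValue : ℕ → ℚ
targetValue m = (+ (24 * m * (2 * ⌈ m /2⌉ ∸ 1))) / suc ((8 * m + 5) * (2 * ⌈ m /2⌉ ∸ 1) + 2)

{-# OPTIONS --safe #-}
module Submission where

-- Write z for the vertex of the part of size 1, and x and y for vertices of the two other parts.  By
-- symmetry there are only two kinds of pairs of nonincident edges: a spoke and a rim edge, z x | y x′,
-- and two rim edges, x y | x′ y′.
--
-- Lower bound: an ordering separates exactly one of u p | v q and u q | v p, unless p and q lie on
-- the same side of the interval from u to v, when it separates neither.  Hence the number of
-- quadruples {z, y, x, x′} or {z, x, y, y′} without a separated pair is the cost of two lattice paths
-- (the numbers of x's and y's met so far, read from either end towards z) plus a boundary term.  A
-- cheapest path stays close to the diagonal, so this number is at least Σ_{i<m} i² − ⌊m/2⌋⌈m/2⌉.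
--
-- Upper bound: the minimum is attained by xyxy…z…xyxy with z in the middle.  The images of this
-- ordering under all permutations of both parts, and under the exchange of the parts, separate the
-- pairs of a spoke and a rim edge equally often, and the pairs of rim edges at least as often.

open import Defs
open import Algebra using (module CommutativeMonoid)
open import Data.Bool using (Bool; true; false; _∧_; _∨_; if_then_else_)
open import Data.Bool.Properties
  using (∨-comm; ∨-identityʳ; ∧-comm; ∧-assoc; ∧-identityʳ; ∧-zeroʳ; ∧-commutativeMonoid)
open import Data.Fin
  using (Fin; zero; suc; toℕ; fromℕ<; combine; opposite; punchIn; splitAt; join) renaming (_≟_ to _≟ᶠ_)
open import Data.Fin.Patterns using (0F; 1F)
open import Data.Fin.Permutation
  using (Permutation′; _⟨$⟩ʳ_; _≈_; _∘ₚ_; cast-id; insert; insert-remove; lift₀; remove; reverse)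
  renaming (id to idₚ)
open import Data.Fin.Properties
  using (*↔×; +↔⊎; all?; any?; join-splitAt; opposite-prop; punchInᵢ≢i; splitAt-join; toℕ-cast;
         toℕ-combine; toℕ-fromℕ<; toℕ-injective; toℕ-↑ˡ; toℕ-↑ʳ; toℕ<n; ↑ˡ-injective; ↑ʳ-injective)
  renaming (suc-injective to suc-injectiveᶠ)
import Data.Integer as ℤ
import Data.Integer.Properties as ℤ
open import Data.List
  using (List; []; _∷_; _++_; allFin; cartesianProductWith; concat; length; lookup; map; replicate; tabulate)
open import Data.List.Membership.Propositional.Properties using (∈-allFin)
open import Data.List.Properties using (length-++)
import Data.List.Relation.Binary.Pointwise as Pointwise
open import Data.List.Relation.Binary.Pointwise using (Pointwise; Pointwise-length)
import Data.List.Relation.Unary.Any as Any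
open import Data.List.Relation.Unary.Any using (Any; here; satisfied)
open import Data.List.Relation.Unary.Any.Properties using (cartesianProductWith⁺)
open import Data.Nat hiding (_/_)
open import Data.Nat.Induction using (<-rec)
open import Data.Nat.Properties
open import Data.Nat.Tactic.RingSolver using (solve; solve-∀)
open import Data.Product using (_×_; _,_; ∃-syntax; proj₁; proj₂)
open import Data.Rational using (_/_; _-_; Positive) renaming (_≤_ to _≤ℚ_; _+_ to _+ℚ_)
import Data.Rational.Properties as ℚ
open import Data.Rational.Unnormalised using (mkℚᵘ; *≤*)
import Data.Rational.Unnormalised.Properties as ℚᵘ
open import Data.Sum using (_⊎_; inj₁; inj₂)
open import Data.Sum.Function.Propositional using (_⊎-↔_)
open import Function using (_∘_; const; id; _↔_; mk⇔; mk↔ₛ′; Injection; Inverse)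
open import Function.Definitions using (Injective)
open import Function.Properties.Inverse using (↔-sym; ↔-trans; ↔⇒↣)
open import Function.Related.TypeIsomorphisms using (⊎-comm)
open import Relation.Binary using (tri<; tri≈; tri>)
open import Relation.Binary.PropositionalEquality
  using (_≡_; _≢_; _≗_; refl; sym; trans; cong; cong₂; subst; subst₂; module ≡-Reasoning)
open import Relation.Nullary using (Dec; yes; no; contradiction; ¬?; _×-dec_; _→-dec_)
open import Relation.Nullary.Decidable using (map′; dec-true; dec-false; does-⇔)

open import Algebra.Properties.Semiring.Sum +-*-semiring
  using (sum; sum-syntax; sum-cong-≗; sum-permute; sum-remove; ∑-distrib-+; ∑-comm;
         *-distribˡ-sum; *-distribʳ-sum)
import Algebra.Properties.CommutativeSemigroup (CommutativeMonoid.commutativeSemigroup ∧-commutativeMonoid) as ∧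
import Algebra.Properties.CommutativeSemigroup +-commutativeSemigroup as +
import Algebra.Properties.CommutativeSemigroup *-commutativeSemigroup as *

-- Finite sums

[_] : Bool → ℕ
[ b ] = if b then 1 else 0

[]-square : ∀ b → [ b ] * [ b ] ≡ [ b ]
[]-square false = refl
[]-square true  = refl

<ᵇ-true : ∀ {a b} → a < b → (a <ᵇ b) ≡ true
<ᵇ-true {a} {b} = dec-true (a <? b)

<ᵇ-false : ∀ {a b} → b ≤ a → (a <ᵇ b) ≡ false
<ᵇ-false {a} {b} b≤a = dec-false (a <? b) (≤⇒≯ b≤a)

<ᵇ-cong : ∀ {a b c d} → (a < b → c < d) → (c < d → a < b) → (a <ᵇ b) ≡ (c <ᵇ d)
<ᵇ-cong {a} {b} {c} {d} to from = does-⇔ (mk⇔ to from) (a <? b) (c <? d)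

[<ᵇ]-trichotomy : ∀ {a b} → a ≢ b → [ a <ᵇ b ] + [ b <ᵇ a ] ≡ 1
[<ᵇ]-trichotomy {a} {b} a≢b with <-cmp a b
... | tri< a<b _ _ rewrite <ᵇ-true a<b | <ᵇ-false (<⇒≤ a<b) = refl
... | tri≈ _ a≡b _ = contradiction a≡b a≢b
... | tri> _ _ b<a rewrite <ᵇ-true b<a | <ᵇ-false (<⇒≤ b<a) = refl

⊓-split : ∀ (f : ℕ → ℕ) {a b} → a ≢ b → f (a ⊓ b) ≡ [ a <ᵇ b ] * f a + [ b <ᵇ a ] * f b
⊓-split f {a} {b} a≢b with <-cmp a b
... | tri< a<b _ _ rewrite <ᵇ-true a<b | <ᵇ-false (<⇒≤ a<b) | m≤n⇒m⊓n≡m (<⇒≤ a<b) =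
  sym (trans (+-identityʳ (f a + 0)) (+-identityʳ (f a)))
... | tri≈ _ a≡b _ = contradiction a≡b a≢b
... | tri> _ _ b<a rewrite <ᵇ-true b<a | <ᵇ-false (<⇒≤ b<a) | m≥n⇒m⊓n≡n (<⇒≤ b<a) =
  sym (+-identityʳ (f b))

∑-const : ∀ n c → ∑[ i < n ] c ≡ n * c
∑-const zero    c = refl
∑-const (suc n) c = cong (c +_) (∑-const n c)

∑-mono : ∀ {n} {f g : Fin n → ℕ} → (∀ i → f i ≤ g i) → sum f ≤ sum g
∑-mono {zero}  f≤g = z≤n
∑-mono {suc n} f≤g = +-mono-≤ (f≤g zero) (∑-mono (f≤g ∘ suc))

∑-zero : ∀ {n} {f : Fin n → ℕ} → (∀ i → f i ≡ 0) → sum f ≡ 0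
∑-zero {n} f≡0 = trans (sum-cong-≗ f≡0) (trans (∑-const n 0) (*-zeroʳ n))

sum-agree-off : ∀ {n} {f g : Fin n → ℕ} k {c} → (∀ i → i ≢ k → f i ≡ g i) → f k ≡ c → g k ≡ 0 →
                sum f ≡ c + sum g
sum-agree-off {suc n} {f} {g} k {c} f≡g fk≡c gk≡0 = begin
  sum f
    ≡⟨ sum-remove {i = k} f ⟩
  f k + ∑[ a < n ] f (punchIn k a)
    ≡⟨ cong₂ _+_ fk≡c (sum-cong-≗ λ a → f≡g (punchIn k a) (punchInᵢ≢i k a)) ⟩
  c + ∑[ a < n ] g (punchIn k a)
    ≡⟨ cong (λ gk → c + (gk + ∑[ a < n ] g (punchIn k a))) gk≡0 ⟨
  c + (g k + ∑[ a < n ] g (punchIn k a))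
    ≡⟨ cong (c +_) (sum-remove {i = k} g) ⟨
  c + sum g ∎
  where open ≡-Reasoning

∑∑ : ∀ {m n} → (Fin m → Fin n → ℕ) → ℕ
∑∑ {m} {n} f = ∑[ i < m ] ∑[ j < n ] f i j

∑∑-cong : ∀ {m n} {f g : Fin m → Fin n → ℕ} → (∀ i j → f i j ≡ g i j) → ∑∑ f ≡ ∑∑ g
∑∑-cong f≡g = sum-cong-≗ λ i → sum-cong-≗ (f≡g i)

∑∑-distrib-+ : ∀ {m n} (f g : Fin m → Fin n → ℕ) → ∑∑ (λ i j → f i j + g i j) ≡ ∑∑ f + ∑∑ g
∑∑-distrib-+ f g = trans (sum-cong-≗ λ i → ∑-distrib-+ (f i) (g i)) (∑-distrib-+ (sum ∘ f) (sum ∘ g))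

∑∑-∑-comm : ∀ {m n o} (f : Fin o → Fin m → Fin n → ℕ) →
            ∑∑ (λ i j → ∑[ k < o ] f k i j) ≡ ∑[ k < o ] ∑∑ (f k)
∑∑-∑-comm f = trans (sum-cong-≗ λ i → ∑-comm (λ j k → f k i j)) (∑-comm (λ i k → sum (f k i)))

*-distribˡ-∑∑ : ∀ {m n} c (f : Fin m → Fin n → ℕ) → c * ∑∑ f ≡ ∑∑ (λ i j → c * f i j)
*-distribˡ-∑∑ c f = trans (*-distribˡ-sum c (sum ∘ f)) (sum-cong-≗ λ i → *-distribˡ-sum c (f i))

∑∑-product : ∀ {m n} (f : Fin m → ℕ) (g : Fin n → ℕ) → ∑∑ (λ i j → f i * g j) ≡ sum f * sum g
∑∑-product f g = trans (sum-cong-≗ λ i → sym (*-distribˡ-sum (f i) g)) (sym (*-distribʳ-sum (sum g) f))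

-- Ordered pairs of distinct elements are counted, rather than unordered ones, so that no division
-- occurs.
pairs : ℕ → ℕ
pairs n = n * pred n

pairs-square : ∀ n → n * n ≡ n + pairs n
pairs-square zero    = refl
pairs-square (suc n) = *-suc (suc n) n

pairs-suc : ∀ n → pairs (suc n) ≡ pairs n + 2 * n
pairs-suc n = begin
  n + n * n            ≡⟨ cong (n +_) (pairs-square n) ⟩
  n + (n + pairs n)    ≡⟨ regroup n (pairs n) ⟩
  pairs n + 2 * n      ∎
  where
  open ≡-Reasoning
  regroup : ∀ n p → n + (n + p) ≡ p + 2 * n
  regroup = solve-∀

pairs-+ : ∀ m n → pairs (m + n) ≡ pairs m + pairs n + 2 * (m * n)
pairs-+ m n = +-cancelˡ-≡ (m + n) _ _ (begin
  m + n + pairs (m + n)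
    ≡⟨ pairs-square (m + n) ⟨
  (m + n) * (m + n)
    ≡⟨ solve (m ∷ n ∷ []) ⟩
  m * m + n * n + 2 * (m * n)
    ≡⟨ cong₂ (λ s t → s + t + 2 * (m * n)) (pairs-square m) (pairs-square n) ⟩
  m + pairs m + (n + pairs n) + 2 * (m * n)
    ≡⟨ regroup m n (pairs m) (pairs n) (m * n) ⟩
  m + n + (pairs m + pairs n + 2 * (m * n)) ∎)
  where
  open ≡-Reasoning
  regroup : ∀ m n p q r → m + p + (n + q) + 2 * r ≡ m + n + (p + q + 2 * r)
  regroup = solve-∀

∑≠ : ∀ {n} → (Fin n → Fin n → ℕ) → ℕ
∑≠ {zero}  f = 0
∑≠ {suc n} f = ∑[ i < suc n ] ∑[ a < n ] f i (punchIn i a)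

∑∑-diagonal : ∀ {n} (f : Fin n → Fin n → ℕ) → ∑∑ f ≡ ∑[ i < n ] f i i + ∑≠ f
∑∑-diagonal {zero}  f = refl
∑∑-diagonal {suc n} f = trans (sum-cong-≗ λ i → sum-remove {i = i} (f i))
                              (∑-distrib-+ (λ i → f i i) (λ i → ∑[ a < n ] f i (punchIn i a)))

∑∑≡∑≠ : ∀ {n} (f : Fin n → Fin n → ℕ) → (∀ i → f i i ≡ 0) → ∑∑ f ≡ ∑≠ f
∑∑≡∑≠ f fii≡0 = trans (∑∑-diagonal f) (cong (_+ ∑≠ f) (∑-zero fii≡0))

∑≠-cong : ∀ {n} {f g : Fin n → Fin n → ℕ} → (∀ {i j} → i ≢ j → f i j ≡ g i j) → ∑≠ f ≡ ∑≠ g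
∑≠-cong {zero}  f≡g = refl
∑≠-cong {suc n} f≡g = ∑∑-cong λ i a → f≡g (punchInᵢ≢i i a ∘ sym)

∑≠-mono : ∀ {n} {f g : Fin n → Fin n → ℕ} → (∀ {i j} → i ≢ j → f i j ≤ g i j) → ∑≠ f ≤ ∑≠ g
∑≠-mono {zero}  f≤g = z≤n
∑≠-mono {suc n} f≤g = ∑-mono λ i → ∑-mono λ a → f≤g (punchInᵢ≢i i a ∘ sym)

∑≠-const : ∀ n c → ∑≠ {n} (λ _ _ → c) ≡ pairs n * c
∑≠-const zero    c = refl
∑≠-const (suc n) c = begin
  ∑[ i < suc n ] ∑[ a < n ] c     ≡⟨ ∑-const (suc n) (∑[ a < n ] c) ⟩
  suc n * ∑[ a < n ] c            ≡⟨ cong (suc n *_) (∑-const n c) ⟩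
  suc n * (n * c)                 ≡⟨ *-assoc (suc n) n c ⟨
  suc n * n * c                   ∎
  where open ≡-Reasoning

∑≠-distrib-+ : ∀ {n} (f g : Fin n → Fin n → ℕ) → ∑≠ (λ i j → f i j + g i j) ≡ ∑≠ f + ∑≠ g
∑≠-distrib-+ {zero}  f g = refl
∑≠-distrib-+ {suc n} f g = ∑∑-distrib-+ (λ i a → f i (punchIn i a)) (λ i a → g i (punchIn i a))

*-distribˡ-∑≠ : ∀ {n} c (f : Fin n → Fin n → ℕ) → c * ∑≠ f ≡ ∑≠ (λ i j → c * f i j)
*-distribˡ-∑≠ {zero}  c f = *-zeroʳ c
*-distribˡ-∑≠ {suc n} c f = *-distribˡ-∑∑ c (λ i a → f i (punchIn i a))

∑≠-comm : ∀ {n} (f : Fin n → Fin n → ℕ) → ∑≠ f ≡ ∑≠ (λ i j → f j i)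
∑≠-comm {n} f = +-cancelˡ-≡ (∑[ i < n ] f i i) _ _ (begin
  ∑[ i < n ] f i i + ∑≠ f                   ≡⟨ ∑∑-diagonal f ⟨
  ∑∑ f                                      ≡⟨ ∑-comm f ⟩
  ∑∑ (λ i j → f j i)                        ≡⟨ ∑∑-diagonal (λ i j → f j i) ⟩
  ∑[ i < n ] f i i + ∑≠ (λ i j → f j i)     ∎)
  where open ≡-Reasoning

∑≠-symmetrised : ∀ {n} (f : Fin n → Fin n → ℕ) → ∑≠ (λ i j → f i j + f j i) ≡ 2 * ∑≠ f
∑≠-symmetrised f = begin
  ∑≠ (λ i j → f i j + f j i)      ≡⟨ ∑≠-distrib-+ f (λ i j → f j i) ⟩
  ∑≠ f + ∑≠ (λ i j → f j i)       ≡⟨ cong (∑≠ f +_) (∑≠-comm f) ⟨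
  ∑≠ f + ∑≠ f                     ≡⟨ cong (∑≠ f +_) (+-identityʳ (∑≠ f)) ⟨
  2 * ∑≠ f                        ∎
  where open ≡-Reasoning

∑≠-[]-product : ∀ {n} (b : Fin n → Bool) → ∑≠ (λ i j → [ b i ] * [ b j ]) ≡ pairs (∑[ i < n ] [ b i ])
∑≠-[]-product {n} b = +-cancelˡ-≡ k _ _ (begin
  k + ∑≠ (λ i j → [ b i ] * [ b j ])
    ≡⟨ cong (_+ ∑≠ (λ i j → [ b i ] * [ b j ])) (sum-cong-≗ ([]-square ∘ b)) ⟨
  ∑[ i < n ] ([ b i ] * [ b i ]) + ∑≠ (λ i j → [ b i ] * [ b j ])
    ≡⟨ ∑∑-diagonal (λ i j → [ b i ] * [ b j ]) ⟨
  ∑∑ (λ i j → [ b i ] * [ b j ])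
    ≡⟨ ∑∑-product ([_] ∘ b) ([_] ∘ b) ⟩
  k * k
    ≡⟨ pairs-square k ⟩
  k + pairs k ∎)
  where
  open ≡-Reasoning
  k : ℕ
  k = ∑[ i < n ] [ b i ]

∑≠-permute : ∀ {n} (f : Fin n → Fin n → ℕ) (π : Permutation′ n) →
             ∑≠ f ≡ ∑≠ (λ i j → f (π ⟨$⟩ʳ i) (π ⟨$⟩ʳ j))
∑≠-permute {n} f π = +-cancelˡ-≡ (∑[ i < n ] f i i) _ _ (begin
  ∑[ i < n ] f i i + ∑≠ f               ≡⟨ ∑∑-diagonal f ⟨
  ∑∑ f                                  ≡⟨ sum-permute (sum ∘ f) π ⟩
  ∑[ i < n ] sum (f (π ⟨$⟩ʳ i))         ≡⟨ sum-cong-≗ (λ i → sum-permute (f (π ⟨$⟩ʳ i)) π) ⟩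
  ∑∑ fπ                                 ≡⟨ ∑∑-diagonal fπ ⟩
  ∑[ i < n ] fπ i i + ∑≠ fπ             ≡⟨ cong (_+ ∑≠ fπ) (sum-permute (λ i → f i i) π) ⟨
  ∑[ i < n ] f i i + ∑≠ fπ              ∎)
  where
  open ≡-Reasoning
  fπ : Fin n → Fin n → ℕ
  fπ i j = f (π ⟨$⟩ʳ i) (π ⟨$⟩ʳ j)

∑-punchIn : ∀ {n} (f : Fin (suc n) → ℕ) → ∑[ k < suc n ] ∑[ a < n ] f (punchIn k a) ≡ n * sum f
∑-punchIn {n} f = +-cancelˡ-≡ (sum f) _ _ (begin
  sum f + ∑[ k < suc n ] ∑[ a < n ] f (punchIn k a)
    ≡⟨ ∑-distrib-+ f (λ k → ∑[ a < n ] f (punchIn k a)) ⟨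
  ∑[ k < suc n ] (f k + ∑[ a < n ] f (punchIn k a))
    ≡⟨ sum-cong-≗ {suc n} (λ k → sum-remove {i = k} f) ⟨
  ∑[ k < suc n ] sum f
    ≡⟨ ∑-const (suc n) (sum f) ⟩
  sum f + n * sum f ∎)
  where open ≡-Reasoning

∑≠-remove : ∀ {n} (f : Fin (suc n) → Fin (suc n) → ℕ) k →
  ∑≠ f ≡ ∑[ a < n ] f k (punchIn k a) + ∑[ a < n ] f (punchIn k a) k
       + ∑≠ (λ a b → f (punchIn k a) (punchIn k b))
∑≠-remove {n} f k = +-cancelˡ-≡ (∑[ i < suc n ] f i i) _ _ (begin
  ∑[ i < suc n ] f i i + ∑≠ f
    ≡⟨ ∑∑-diagonal f ⟨
  ∑∑ f
    ≡⟨ sum-remove {i = k} (sum ∘ f) ⟩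
  sum (f k) + ∑[ a < n ] sum (f (punchIn k a))
    ≡⟨ cong₂ _+_ (sum-remove {i = k} (f k)) (sum-cong-≗ λ a → sum-remove {i = k} (f (punchIn k a))) ⟩
  f k k + row + ∑[ a < n ] (f (punchIn k a) k + sum (minor a))
    ≡⟨ cong (f k k + row +_) (∑-distrib-+ (λ a → f (punchIn k a) k) (sum ∘ minor)) ⟩
  f k k + row + (column + ∑∑ minor)
    ≡⟨ cong (λ s → f k k + row + (column + s)) (∑∑-diagonal minor) ⟩
  f k k + row + (column + (∑[ a < n ] minor a a + ∑≠ minor))
    ≡⟨ regroup (f k k) row column (∑[ a < n ] minor a a) (∑≠ minor) ⟩
  f k k + ∑[ a < n ] minor a a + (row + column + ∑≠ minor)
    ≡⟨ cong (_+ (row + column + ∑≠ minor)) (sum-remove {i = k} (λ i → f i i)) ⟨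
  ∑[ i < suc n ] f i i + (row + column + ∑≠ minor) ∎)
  where
  open ≡-Reasoning
  row column : ℕ
  row    = ∑[ a < n ] f k (punchIn k a)
  column = ∑[ a < n ] f (punchIn k a) k
  minor : Fin n → Fin n → ℕ
  minor a b = f (punchIn k a) (punchIn k b)
  regroup : ∀ d r c e s → d + r + (c + (e + s)) ≡ d + e + (r + c + s)
  regroup = solve-∀

∑≠-punchIn : ∀ {n} (f : Fin (2 + n) → Fin (2 + n) → ℕ) →
  ∑[ k < 2 + n ] ∑≠ (λ a b → f (punchIn k a) (punchIn k b)) ≡ n * ∑≠ f
∑≠-punchIn {n} f = +-cancelˡ-≡ (∑≠ f + ∑≠ f) _ _ (begin
  ∑≠ f + ∑≠ f + sum minor
    ≡⟨ cong (λ s → ∑≠ f + s + sum minor) (∑≠-comm f) ⟩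
  sum row + sum column + sum minor
    ≡⟨ cong (_+ sum minor) (∑-distrib-+ row column) ⟨
  ∑[ k < 2 + n ] (row k + column k) + sum minor
    ≡⟨ ∑-distrib-+ (λ k → row k + column k) minor ⟨
  ∑[ k < 2 + n ] (row k + column k + minor k)
    ≡⟨ sum-cong-≗ {2 + n} (∑≠-remove f) ⟨
  ∑[ k < 2 + n ] ∑≠ f
    ≡⟨ ∑-const (2 + n) (∑≠ f) ⟩
  (2 + n) * ∑≠ f
    ≡⟨ +-assoc (∑≠ f) (∑≠ f) (n * ∑≠ f) ⟨
  ∑≠ f + ∑≠ f + n * ∑≠ f ∎)
  where
  open ≡-Reasoning
  row column minor : Fin (2 + n) → ℕ
  row k    = ∑[ a < suc n ] f k (punchIn k a)
  column k = ∑[ a < suc n ] f (punchIn k a) k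
  minor k  = ∑≠ (λ a b → f (punchIn k a) (punchIn k b))

-- Separated pairs of edges in terms of positions

before : ℕ → ℕ → ℕ → ℕ → Bool
before a b c d = (a <ᵇ c) ∧ (a <ᵇ d) ∧ (b <ᵇ c) ∧ (b <ᵇ d)

sep : ℕ → ℕ → ℕ → ℕ → Bool
sep a b c d = before a b c d ∨ before c d a b

sep-cong : ∀ {a a′ b b′ c c′ d d′} → a ≡ a′ → b ≡ b′ → c ≡ c′ → d ≡ d′ →
           sep a b c d ≡ sep a′ b′ c′ d′
sep-cong refl refl refl refl = refl

sep-swap : ∀ a b c d → sep a b c d ≡ sep c d a b
sep-swap a b c d = ∨-comm (before a b c d) (before c d a b)

before-flipˡ : ∀ a b c d → before a b c d ≡ before b a c d
before-flipˡ a b c d = begin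
  (a <ᵇ c) ∧ (a <ᵇ d) ∧ (b <ᵇ c) ∧ (b <ᵇ d)
    ≡⟨ ∧-assoc (a <ᵇ c) (a <ᵇ d) ((b <ᵇ c) ∧ (b <ᵇ d)) ⟨
  ((a <ᵇ c) ∧ (a <ᵇ d)) ∧ (b <ᵇ c) ∧ (b <ᵇ d)
    ≡⟨ ∧-comm ((a <ᵇ c) ∧ (a <ᵇ d)) ((b <ᵇ c) ∧ (b <ᵇ d)) ⟩
  ((b <ᵇ c) ∧ (b <ᵇ d)) ∧ (a <ᵇ c) ∧ (a <ᵇ d)
    ≡⟨ ∧-assoc (b <ᵇ c) (b <ᵇ d) ((a <ᵇ c) ∧ (a <ᵇ d)) ⟩
  (b <ᵇ c) ∧ (b <ᵇ d) ∧ (a <ᵇ c) ∧ (a <ᵇ d) ∎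
  where open ≡-Reasoning

before-flipʳ : ∀ a b c d → before a b c d ≡ before a b d c
before-flipʳ a b c d = trans (∧.x∙yz≈y∙xz (a <ᵇ c) (a <ᵇ d) _)
  (cong (λ t → (a <ᵇ d) ∧ (a <ᵇ c) ∧ t) (∧-comm (b <ᵇ c) (b <ᵇ d)))

sep-flipˡ : ∀ a b c d → sep a b c d ≡ sep b a c d
sep-flipˡ a b c d = cong₂ _∨_ (before-flipˡ a b c d) (before-flipʳ c d a b)

sep-flips : ∀ a b c d → sep a b c d ≡ sep b a d c
sep-flips a b c d = begin
  sep a b c d   ≡⟨ sep-flipˡ a b c d ⟩
  sep b a c d   ≡⟨ sep-swap b a c d ⟩
  sep c d b a   ≡⟨ sep-flipˡ c d b a ⟩
  sep d c b a   ≡⟨ sep-swap d c b a ⟩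
  sep b a d c   ∎
  where open ≡-Reasoning

before-incident : ∀ a b c → before a b c b ≡ false
before-incident a b c rewrite <ᵇ-false (≤-refl {b}) | ∧-zeroʳ (b <ᵇ c) | ∧-zeroʳ (a <ᵇ b) = ∧-zeroʳ (a <ᵇ c)

sep-incidentʳ : ∀ a b c → sep a b c b ≡ false
sep-incidentʳ a b c = cong₂ _∨_ (before-incident a b c) (before-incident c b a)

sep-incidentˡ : ∀ a b c → sep a b a c ≡ false
sep-incidentˡ a b c = trans (sep-flips a b a c) (sep-incidentʳ b a c)

sep-parallel : ∀ {u v p q} → u < v → p < q → sep u p v q ≡ (u <ᵇ q) ∧ (p <ᵇ v)
sep-parallel {u} {v} {p} {q} u<v p<q rewrite <ᵇ-true u<v | <ᵇ-true p<q | <ᵇ-false (<⇒≤ u<v) =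
  trans (∨-identityʳ _) (cong ((u <ᵇ q) ∧_) (∧-identityʳ (p <ᵇ v)))

sep-crossed : ∀ {u v p q} → u < v → p < q → sep u q v p ≡ false
sep-crossed {u} {v} {p} {q} u<v p<q
  rewrite <ᵇ-false (<⇒≤ p<q) | <ᵇ-false (<⇒≤ u<v)
        | ∧-zeroʳ (q <ᵇ v) | ∧-zeroʳ (u <ᵇ p) | ∧-zeroʳ (u <ᵇ v) = refl

intervals-trichotomy : ∀ {u v p q} → u < v → p < q → q ≢ u → p ≢ v →
  [ (u <ᵇ q) ∧ (p <ᵇ v) ] + ([ p <ᵇ u ] * [ q <ᵇ u ] + [ v <ᵇ p ] * [ v <ᵇ q ]) ≡ 1
intervals-trichotomy {u} {v} {p} {q} u<v p<q q≢u p≢v with <-cmp q u | <-cmp p v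
... | tri≈ _ q≡u _ | _            = contradiction q≡u q≢u
... | _            | tri≈ _ p≡v _ = contradiction p≡v p≢v
... | tri< q<u _ _ | _
  rewrite <ᵇ-false (<⇒≤ q<u) | <ᵇ-true (<-trans p<q q<u) | <ᵇ-true q<u
        | <ᵇ-false (<⇒≤ (<-trans p<q (<-trans q<u u<v))) = refl
... | tri> _ _ u<q | tri< p<v _ _
  rewrite <ᵇ-true u<q | <ᵇ-true p<v | <ᵇ-false (<⇒≤ u<q) | <ᵇ-false (<⇒≤ p<v) | *-zeroʳ [ p <ᵇ u ] = refl
... | tri> _ _ u<q | tri> _ _ v<p
  rewrite <ᵇ-true u<q | <ᵇ-false (<⇒≤ v<p) | <ᵇ-false (<⇒≤ u<q) | <ᵇ-true v<p | <ᵇ-true (<-trans v<p p<q)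
        | *-zeroʳ [ p <ᵇ u ] = refl

sep-matchings : ∀ {u v p q} → u < v → p ≢ u → p ≢ v → q ≢ u → q ≢ v → p ≢ q →
  [ sep u p v q ] + [ sep u q v p ] + ([ p <ᵇ u ] * [ q <ᵇ u ] + [ v <ᵇ p ] * [ v <ᵇ q ]) ≡ 1
sep-matchings {u} {v} {p} {q} u<v p≢u p≢v q≢u q≢v p≢q with <-cmp p q
... | tri≈ _ p≡q _ = contradiction p≡q p≢q
... | tri< p<q _ _
  rewrite sep-parallel u<v p<q | sep-crossed u<v p<q | +-identityʳ [ (u <ᵇ q) ∧ (p <ᵇ v) ] =
  intervals-trichotomy u<v p<q q≢u p≢v
... | tri> _ _ q<p
  rewrite sep-parallel u<v q<p | sep-crossed u<v q<p
        | *-comm [ p <ᵇ u ] [ q <ᵇ u ] | *-comm [ v <ᵇ p ] [ v <ᵇ q ] =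
  intervals-trichotomy u<v q<p p≢u q≢v

Avoids : ∀ {n} → (Fin n → ℕ) → ℕ → Set
Avoids p t = ∀ i → p i ≢ t

below above : ∀ {n} → (Fin n → ℕ) → ℕ → ℕ
below {n} p t = ∑[ i < n ] [ p i <ᵇ t ]
above {n} p t = ∑[ i < n ] [ t <ᵇ p i ]

below+above : ∀ {n} {p : Fin n → ℕ} {t} → Avoids p t → below p t + above p t ≡ n
below+above {n} {p} {t} p≢t = begin
  below p t + above p t                       ≡⟨ ∑-distrib-+ (λ i → [ p i <ᵇ t ]) (λ i → [ t <ᵇ p i ]) ⟨
  ∑[ i < n ] ([ p i <ᵇ t ] + [ t <ᵇ p i ])    ≡⟨ sum-cong-≗ ([<ᵇ]-trichotomy ∘ p≢t) ⟩
  ∑[ i < n ] 1                                ≡⟨ ∑-const n 1 ⟩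
  n * 1                                       ≡⟨ *-identityʳ n ⟩
  n                                           ∎
  where open ≡-Reasoning

above-complement : ∀ {n} {p : Fin n → ℕ} {t k l} → Avoids p t → below p t ≡ k → k + l ≡ n → above p t ≡ l
above-complement p≢t refl k+l≡n = +-cancelˡ-≡ _ _ _ (trans (below+above p≢t) (sym k+l≡n))

[<ᵇ]-mono : ∀ {a b c d} → (a < b → c < d) → [ a <ᵇ b ] ≤ [ c <ᵇ d ]
[<ᵇ]-mono {a} {b} a<b⇒c<d with a <? b
... | yes a<b rewrite <ᵇ-true a<b | <ᵇ-true (a<b⇒c<d a<b) = ≤-refl
... | no  a≮b rewrite <ᵇ-false (≮⇒≥ a≮b) = z≤n

below-mono : ∀ {n} (p : Fin n → ℕ) {s t} → s ≤ t → below p s ≤ below p t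
below-mono {n} p {s} s≤t = ∑-mono {n} λ i → [<ᵇ]-mono {p i} {s} λ pi<s → <-≤-trans pi<s s≤t

above-antimono : ∀ {n} (p : Fin n → ℕ) {s t} → s ≤ t → above p t ≤ above p s
above-antimono {n} p {_} {t} s≤t = ∑-mono {n} λ i → [<ᵇ]-mono {t} {p i} λ t<pi → ≤-<-trans s≤t t<pi

below-⊓ : ∀ {n} (p : Fin n → ℕ) s t → below p (s ⊓ t) ≡ below p s ⊓ below p t
below-⊓ p = mono-≤-distrib-⊓ (below-mono p)

above-⊔ : ∀ {n} (p : Fin n → ℕ) s t → above p (s ⊔ t) ≡ above p s ⊓ above p t
above-⊔ p = antimono-≤-distrib-⊔ (above-antimono p)

crossings : ∀ {n} → ℕ → ℕ → (Fin n → ℕ) → ℕ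
crossings u v p = ∑∑ λ i j → [ sep u (p i) v (p j) ]

crossings-cong : ∀ {n u u′ v v′} {p p′ : Fin n → ℕ} → u ≡ u′ → v ≡ v′ → p ≗ p′ →
                 crossings u v p ≡ crossings u′ v′ p′
crossings-cong {u = u} {v = v} refl refl p≗p′ =
  ∑∑-cong λ i j → cong₂ (λ a b → [ sep u a v b ]) (p≗p′ i) (p≗p′ j)

crossings-comm : ∀ {n} u v (p : Fin n → ℕ) → crossings u v p ≡ crossings v u p
crossings-comm u v p = trans (∑-comm (λ i j → [ sep u (p i) v (p j) ]))
                             (∑∑-cong λ j i → cong [_] (sep-swap u (p i) v (p j)))

crossings-self : ∀ {n} u (p : Fin n → ℕ) → crossings u u p ≡ 0
crossings-self u p = ∑-zero λ i → ∑-zero λ j → cong [_] (sep-incidentˡ u (p i) (p j))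

∑∑-crossings-comm : ∀ {m n} (p : Fin m → ℕ) (q : Fin n → ℕ) →
  ∑∑ (λ i j → crossings (p i) (p j) q) ≡ ∑∑ (λ k l → crossings (q k) (q l) p)
∑∑-crossings-comm {m} {n} p q = begin
  ∑∑ (λ i j → ∑∑ λ k l → [ sep (p i) (q k) (p j) (q l) ])
    ≡⟨ ∑∑-∑-comm (λ k i j → ∑[ l < n ] [ sep (p i) (q k) (p j) (q l) ]) ⟩
  ∑[ k < n ] ∑∑ (λ i j → ∑[ l < n ] [ sep (p i) (q k) (p j) (q l) ])
    ≡⟨ sum-cong-≗ (λ k → ∑∑-∑-comm (λ l i j → [ sep (p i) (q k) (p j) (q l) ])) ⟩
  ∑∑ (λ k l → ∑∑ λ i j → [ sep (p i) (q k) (p j) (q l) ])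
    ≡⟨ ∑∑-cong (λ k l → ∑∑-cong λ i j → cong [_] (sep-flips (p i) (q k) (p j) (q l))) ⟩
  ∑∑ (λ k l → crossings (q k) (q l) p) ∎
  where open ≡-Reasoning

crossings-< : ∀ {n u v} {p : Fin n → ℕ} → Injective _≡_ _≡_ p → Avoids p u → Avoids p v → u < v →
              2 * crossings u v p + (pairs (below p u) + pairs (above p v)) ≡ pairs n
crossings-< {n} {u} {v} {p} p-injective p≢u p≢v u<v = begin
  2 * crossings u v p + (pairs (below p u) + pairs (above p v))
    ≡⟨ cong (λ c → 2 * c + (pairs (below p u) + pairs (above p v)))
            (∑∑≡∑≠ separated λ i → cong [_] (sep-incidentʳ u (p i) v)) ⟩
  2 * ∑≠ separated + (pairs (below p u) + pairs (above p v))
    ≡⟨ cong (2 * ∑≠ separated +_)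
            (cong₂ _+_ (∑≠-[]-product (λ i → p i <ᵇ u)) (∑≠-[]-product (λ i → v <ᵇ p i))) ⟨
  2 * ∑≠ separated + (∑≠ bothBelow + ∑≠ bothAbove)
    ≡⟨ cong₂ _+_ (∑≠-symmetrised separated) (∑≠-distrib-+ bothBelow bothAbove) ⟨
  ∑≠ (λ i j → separated i j + separated j i) + ∑≠ (λ i j → bothBelow i j + bothAbove i j)
    ≡⟨ ∑≠-distrib-+ (λ i j → separated i j + separated j i) (λ i j → bothBelow i j + bothAbove i j) ⟨
  ∑≠ (λ i j → separated i j + separated j i + (bothBelow i j + bothAbove i j))
    ≡⟨ ∑≠-cong (λ {i} {j} i≢j → sep-matchings u<v (p≢u i) (p≢v i) (p≢u j) (p≢v j) (i≢j ∘ p-injective)) ⟩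
  ∑≠ {n} (λ _ _ → 1)
    ≡⟨ trans (∑≠-const n 1) (*-identityʳ (pairs n)) ⟩
  pairs n ∎
  where
  open ≡-Reasoning
  separated bothBelow bothAbove : Fin n → Fin n → ℕ
  separated i j = [ sep u (p i) v (p j) ]
  bothBelow i j = [ p i <ᵇ u ] * [ p j <ᵇ u ]
  bothAbove i j = [ v <ᵇ p i ] * [ v <ᵇ p j ]

crossings-identity : ∀ {n u v} {p : Fin n → ℕ} → Injective _≡_ _≡_ p → Avoids p u → Avoids p v → u ≢ v →
                     2 * crossings u v p + (pairs (below p (u ⊓ v)) + pairs (above p (u ⊔ v))) ≡ pairs n
crossings-identity {n} {u} {v} {p} p-injective p≢u p≢v u≢v with <-cmp u v
... | tri≈ _ u≡v _ = contradiction u≡v u≢v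
... | tri< u<v _ _ rewrite m≤n⇒m⊓n≡m (<⇒≤ u<v) | m≤n⇒m⊔n≡n (<⇒≤ u<v) = crossings-< p-injective p≢u p≢v u<v
... | tri> _ _ v<u rewrite m≥n⇒m⊓n≡n (<⇒≤ v<u) | m≥n⇒m⊔n≡m (<⇒≤ v<u) | crossings-comm u v p =
  crossings-< p-injective p≢v p≢u v<u

-- Partial sums

partialSum : (ℕ → ℕ) → ℕ → ℕ
partialSum f n = ∑[ i < n ] f (toℕ i)

partialSum-suc : ∀ f n → partialSum f (suc n) ≡ partialSum f n + f n
partialSum-suc f zero    = +-identityʳ (f 0)
partialSum-suc f (suc n) = trans (cong (f 0 +_) (partialSum-suc (f ∘ suc) n))
                                 (sym (+-assoc (f 0) (partialSum (f ∘ suc) n) (f (suc n))))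

partialSum-+ : ∀ f m n → partialSum f (m + n) ≡ partialSum f m + partialSum (f ∘ (m +_)) n
partialSum-+ f zero    n = refl
partialSum-+ f (suc m) n = trans (cong (f 0 +_) (partialSum-+ (f ∘ suc) m n))
                                 (sym (+-assoc (f 0) (partialSum (f ∘ suc) m) _))

partialSum-eventually-const : ∀ {f g c} h k → (∀ {i} → i < h → g i ≡ f i) → (∀ i → g (h + i) ≡ c) →
                              partialSum g (h + k) ≡ partialSum f h + k * c
partialSum-eventually-const {f} {g} {c} h k g≡f g≡c = begin
  partialSum g (h + k)
    ≡⟨ partialSum-+ g h k ⟩
  partialSum g h + partialSum (g ∘ (h +_)) k
    ≡⟨ cong₂ _+_ (sum-cong-≗ (g≡f ∘ toℕ<n)) (trans (sum-cong-≗ {k} (g≡c ∘ toℕ)) (∑-const k c)) ⟩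
  partialSum f h + k * c ∎
  where open ≡-Reasoning

∑-[<ᵇ] : ∀ n t → ∑[ i < n ] [ toℕ i <ᵇ t ] ≡ n ⊓ t
∑-[<ᵇ] zero    t       = refl
∑-[<ᵇ] (suc n) zero    = ∑-zero {suc n} λ _ → refl
∑-[<ᵇ] (suc n) (suc t) = cong suc (∑-[<ᵇ] n t)

∑-[]-initial : ∀ {n t} {b : Fin n → Bool} → t ≤ n → (∀ i → b i ≡ (toℕ i <ᵇ t)) → ∑[ i < n ] [ b i ] ≡ t
∑-[]-initial {n} {t} t≤n b≡ = trans (sum-cong-≗ (cong [_] ∘ b≡)) (trans (∑-[<ᵇ] n t) (m≥n⇒m⊓n≡n t≤n))

∑-[<ᵇ]-weighted : ∀ f {n t} → t ≤ n → ∑[ i < n ] ([ toℕ i <ᵇ t ] * f (toℕ i)) ≡ partialSum f t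
∑-[<ᵇ]-weighted f {n} z≤n   = ∑-zero {n} λ _ → refl
∑-[<ᵇ]-weighted f (s≤s t≤n) = cong₂ _+_ (*-identityˡ (f 0)) (∑-[<ᵇ]-weighted (f ∘ suc) t≤n)

∑≠-⊓ : ∀ f n → ∑≠ {n} (λ k l → f (toℕ k ⊓ toℕ l)) ≡ 2 * partialSum (partialSum f) n
∑≠-⊓ f n = begin
  ∑≠ {n} (λ k l → f (toℕ k ⊓ toℕ l))
    ≡⟨ ∑≠-cong {n} (λ k≢l → ⊓-split f (k≢l ∘ toℕ-injective)) ⟩
  ∑≠ (λ k l → lesser k l + lesser l k)
    ≡⟨ ∑≠-symmetrised lesser ⟩
  2 * ∑≠ lesser
    ≡⟨ cong (2 *_) (∑∑≡∑≠ lesser (λ k → cong (λ b → [ b ] * f (toℕ k)) (<ᵇ-false (≤-refl {toℕ k})))) ⟨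
  2 * ∑∑ lesser
    ≡⟨ cong (2 *_) (∑-comm lesser) ⟩
  2 * ∑[ l < n ] ∑[ k < n ] lesser k l
    ≡⟨ cong (2 *_) (sum-cong-≗ {n} (λ l → ∑-[<ᵇ]-weighted f (<⇒≤ (toℕ<n l)))) ⟩
  2 * partialSum (partialSum f) n ∎
  where
  open ≡-Reasoning
  lesser : Fin n → Fin n → ℕ
  lesser k l = [ toℕ k <ᵇ toℕ l ] * f (toℕ k)

squareSum : ℕ → ℕ
squareSum = partialSum λ i → i * i

partialSum-pairs : ∀ n → partialSum (pairs ∘ suc) n + partialSum pairs n ≡ 2 * squareSum n
partialSum-pairs n = begin
  partialSum (pairs ∘ suc) n + partialSum pairs n
    ≡⟨ ∑-distrib-+ {n} (pairs ∘ suc ∘ toℕ) (pairs ∘ toℕ) ⟨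
  ∑[ i < n ] (pairs (suc (toℕ i)) + pairs (toℕ i))
    ≡⟨ sum-cong-≗ {n} (consecutive ∘ toℕ) ⟩
  ∑[ i < n ] (2 * (toℕ i * toℕ i))
    ≡⟨ *-distribˡ-sum {n} 2 (λ i → toℕ i * toℕ i) ⟨
  2 * squareSum n ∎
  where
  open ≡-Reasoning
  regroup : ∀ k s p → k + s + p ≡ s + (k + p)
  regroup = solve-∀
  consecutive : ∀ k → pairs (suc k) + pairs k ≡ 2 * (k * k)
  consecutive k = begin
    k + k * k + pairs k       ≡⟨ regroup k (k * k) (pairs k) ⟩
    k * k + (k + pairs k)     ≡⟨ cong (k * k +_) (pairs-square k) ⟨
    k * k + k * k             ≡⟨ cong (k * k +_) (+-identityʳ (k * k)) ⟨
    2 * (k * k)               ∎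

∑-partialSum-pairs : ∀ n → 2 * partialSum (partialSum pairs) n + 2 * partialSum (partialSum (pairs ∘ suc)) n
                         ≡ 4 * partialSum squareSum n
∑-partialSum-pairs n = begin
  2 * partialSum (partialSum pairs) n + 2 * partialSum (partialSum (pairs ∘ suc)) n
    ≡⟨ collect (partialSum (partialSum pairs) n) (partialSum (partialSum (pairs ∘ suc)) n) ⟩
  2 * (partialSum (partialSum (pairs ∘ suc)) n + partialSum (partialSum pairs) n)
    ≡⟨ cong (2 *_) (∑-distrib-+ {n} (partialSum (pairs ∘ suc) ∘ toℕ) (partialSum pairs ∘ toℕ)) ⟨
  2 * ∑[ i < n ] (partialSum (pairs ∘ suc) (toℕ i) + partialSum pairs (toℕ i))
    ≡⟨ cong (2 *_) (sum-cong-≗ {n} (partialSum-pairs ∘ toℕ)) ⟩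
  2 * ∑[ i < n ] (2 * squareSum (toℕ i))
    ≡⟨ cong (2 *_) (*-distribˡ-sum {n} 2 (squareSum ∘ toℕ)) ⟨
  2 * (2 * partialSum squareSum n)
    ≡⟨ *-assoc 2 2 (partialSum squareSum n) ⟨
  4 * partialSum squareSum n ∎
  where
  open ≡-Reasoning
  collect : ∀ a b → 2 * a + 2 * b ≡ 2 * (b + a)
  collect = solve-∀

squareSum-+ : ∀ h k → squareSum (h + k) ≡ squareSum h + squareSum k + (h * (k * k) + k * pairs h)
squareSum-+ zero    k = sym (trans (cong (squareSum k +_) (*-zeroʳ k)) (+-identityʳ (squareSum k)))
squareSum-+ (suc h) k = begin
  squareSum (suc h + k)
    ≡⟨ partialSum-suc (λ i → i * i) (h + k) ⟩
  squareSum (h + k) + (h + k) * (h + k)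
    ≡⟨ cong (_+ (h + k) * (h + k)) (squareSum-+ h k) ⟩
  squareSum h + squareSum k + (h * (k * k) + k * pairs h) + (h + k) * (h + k)
    ≡⟨ regroup h k (squareSum h) (squareSum k) (pairs h) ⟩
  squareSum h + h * h + squareSum k + (suc h * (k * k) + k * (pairs h + 2 * h))
    ≡⟨ cong₂ (λ s p → s + squareSum k + (suc h * (k * k) + k * p))
             (partialSum-suc (λ i → i * i) h) (pairs-suc h) ⟨
  squareSum (suc h) + squareSum k + (suc h * (k * k) + k * pairs (suc h)) ∎
  where
  open ≡-Reasoning
  regroup : ∀ h k s t p → s + t + (h * (k * k) + k * p) + (h + k) * (h + k)
                        ≡ s + h * h + t + (suc h * (k * k) + k * (p + 2 * h))
  regroup = solve-∀

squareSum≤n*pairs : ∀ n → squareSum n ≤ n * pairs n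
squareSum≤n*pairs zero    = z≤n
squareSum≤n*pairs (suc n) = begin
  squareSum (suc n)
    ≡⟨ partialSum-suc (λ i → i * i) n ⟩
  squareSum n + n * n
    ≤⟨ +-monoˡ-≤ (n * n) (squareSum≤n*pairs n) ⟩
  n * pairs n + n * n
    ≤⟨ m≤m+n (n * pairs n + n * n) (pairs n + 2 * n + n * n) ⟩
  n * pairs n + n * n + (pairs n + 2 * n + n * n)
    ≡⟨ collect n (pairs n) ⟩
  suc n * (pairs n + 2 * n)
    ≡⟨ cong (suc n *_) (pairs-suc n) ⟨
  suc n * pairs (suc n) ∎
  where
  open ≤-Reasoning
  collect : ∀ n p → n * p + n * n + (p + 2 * n + n * n) ≡ suc n * (p + 2 * n)
  collect = solve-∀

-- Lattice paths

-- A monotone lattice path pays pairs b for a step (a , b) → (suc a , b) and pairs a for a step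
-- (a , b) → (a , suc b); pathCost a b is the least cost of a path from the origin to (a , b).
pathCost : ℕ → ℕ → ℕ
pathCost zero    b       = 0
pathCost (suc a) zero    = 0
pathCost (suc a) (suc b) = pathCost a b + 2 * (a * b)

pathCost-comm : ∀ a b → pathCost a b ≡ pathCost b a
pathCost-comm zero    zero    = refl
pathCost-comm zero    (suc b) = refl
pathCost-comm (suc a) zero    = refl
pathCost-comm (suc a) (suc b) = cong₂ (λ c p → c + 2 * p) (pathCost-comm a b) (*-comm a b)

pathCost-step : ∀ a b → pathCost (suc a) b ≤ pathCost a b + pairs b
pathCost-step a       zero    = z≤n
pathCost-step zero    (suc b) = z≤n
pathCost-step (suc a) (suc b) = begin
  pathCost (suc a) b + 2 * (suc a * b)
    ≤⟨ +-monoˡ-≤ (2 * (suc a * b)) (pathCost-step a b) ⟩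
  pathCost a b + pairs b + 2 * (suc a * b)
    ≡⟨ regroup (pathCost a b) (pairs b) a b ⟩
  pathCost a b + 2 * (a * b) + (pairs b + 2 * b)
    ≡⟨ cong (pathCost a b + 2 * (a * b) +_) (pairs-suc b) ⟨
  pathCost a b + 2 * (a * b) + pairs (suc b) ∎
  where
  open ≤-Reasoning
  regroup : ∀ c p a b → c + p + 2 * (suc a * b) ≡ c + 2 * (a * b) + (p + 2 * b)
  regroup = solve-∀

pathCost-diagonal : ∀ b d → pathCost (b + d) b ≡ 2 * squareSum b + d * pairs b
pathCost-diagonal zero    d = trans (pathCost-comm d 0) (sym (*-zeroʳ d))
pathCost-diagonal (suc b) d = begin
  pathCost (b + d) b + 2 * ((b + d) * b)
    ≡⟨ cong (_+ 2 * ((b + d) * b)) (pathCost-diagonal b d) ⟩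
  2 * squareSum b + d * pairs b + 2 * ((b + d) * b)
    ≡⟨ regroup b d (squareSum b) (pairs b) ⟩
  2 * (squareSum b + b * b) + d * (pairs b + 2 * b)
    ≡⟨ cong₂ (λ s p → 2 * s + d * p) (partialSum-suc (λ i → i * i) b) (pairs-suc b) ⟨
  2 * squareSum (suc b) + d * pairs (suc b) ∎
  where
  open ≡-Reasoning
  regroup : ∀ b d s p → 2 * s + d * p + 2 * ((b + d) * b) ≡ 2 * (s + b * b) + d * (p + 2 * b)
  regroup = solve-∀

pathCost-square : ∀ b → pathCost b b ≡ 2 * squareSum b
pathCost-square b = begin
  pathCost b b          ≡⟨ cong (λ a → pathCost a b) (+-identityʳ b) ⟨
  pathCost (b + 0) b    ≡⟨ pathCost-diagonal b 0 ⟩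
  2 * squareSum b + 0   ≡⟨ +-identityʳ (2 * squareSum b) ⟩
  2 * squareSum b       ∎
  where open ≡-Reasoning

-- The least number of unseparated pairs due to one side of z, with a and b points of the two
-- families on that side and a′ and b′ points beyond z.
sideCost : ℕ → ℕ → ℕ → ℕ → ℕ
sideCost a b a′ b′ = pathCost a b + (b′ * pairs a + a′ * pairs b)

partialSum-pairs-⊓ : ∀ {m} h k → h + k ≡ m →
  partialSum (λ i → pairs (suc i ⊓ h)) m + partialSum (λ i → pairs (i ⊓ h)) m ≡ sideCost h h k k
partialSum-pairs-⊓ h k refl = begin
  partialSum (λ i → pairs (suc i ⊓ h)) (h + k) + partialSum (λ i → pairs (i ⊓ h)) (h + k)
    ≡⟨ cong₂ _+_
         (partialSum-eventually-const h k (λ i<h → cong pairs (m≤n⇒m⊓n≡m i<h))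
                                          (λ i → cong pairs (m≥n⇒m⊓n≡n (m≤n⇒m≤1+n (m≤m+n h i)))))
         (partialSum-eventually-const h k (λ i<h → cong pairs (m≤n⇒m⊓n≡m (<⇒≤ i<h)))
                                          (λ i → cong pairs (m≥n⇒m⊓n≡n (m≤m+n h i)))) ⟩
  partialSum (pairs ∘ suc) h + k * pairs h + (partialSum pairs h + k * pairs h)
    ≡⟨ +.interchange (partialSum (pairs ∘ suc) h) (k * pairs h) (partialSum pairs h) (k * pairs h) ⟩
  partialSum (pairs ∘ suc) h + partialSum pairs h + (k * pairs h + k * pairs h)
    ≡⟨ cong (_+ (k * pairs h + k * pairs h)) (trans (partialSum-pairs h) (sym (pathCost-square h))) ⟩
  sideCost h h k k ∎
  where open ≡-Reasoning

cutCost : ℕ → ℕ → ℕ → ℕ → ℕ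
cutCost a b a′ b′ = sideCost a b a′ b′ + sideCost a′ b′ a b

sideCost-swap : ∀ a b a′ b′ → sideCost a b a′ b′ ≡ sideCost b a b′ a′
sideCost-swap a b a′ b′ = cong₂ _+_ (pathCost-comm a b) (+-comm (b′ * pairs a) (a′ * pairs b))

cutCost-identity : ∀ b u d → cutCost (b + d) b u (u + d) + 2 * (b * u) + 2 * squareSum d
                           ≡ 2 * squareSum (b + u + d) + ((b + u) * pairs d + 2 * (d * pairs d))
cutCost-identity b u d
  rewrite pathCost-comm u (u + d) | pathCost-diagonal b d | pathCost-diagonal u d
        | squareSum-+ (b + u) d | squareSum-+ b u | pairs-+ b d | pairs-+ u d | pairs-+ b u | pairs-square u
  = expanded b u d (squareSum b) (squareSum u) (squareSum d) (pairs b) (pairs u) (pairs d)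
  where
  expanded : ∀ b u d sb su sd pb pu pd →
    2 * sb + d * pb + ((u + d) * (pb + pd + 2 * (b * d)) + u * pb)
      + (2 * su + d * pu + (b * pu + (b + d) * (pu + pd + 2 * (u * d)))) + 2 * (b * u) + 2 * sd
    ≡ 2 * (sb + su + (b * (u + pu) + u * pb) + sd + ((b + u) * (d * d) + d * (pb + pu + 2 * (b * u))))
      + ((b + u) * pd + 2 * (d * pd))
  expanded = solve-∀

cutCost-square : ∀ h k → cutCost h h k k + 2 * (h * k) ≡ 2 * squareSum (h + k)
cutCost-square h k = begin
  cutCost h h k k + 2 * (h * k)
    ≡⟨ cong₂ (λ a b → cutCost a h k b + 2 * (h * k)) (+-identityʳ h) (+-identityʳ k) ⟨
  cutCost (h + 0) h k (k + 0) + 2 * (h * k)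
    ≡⟨ +-identityʳ (cutCost (h + 0) h k (k + 0) + 2 * (h * k)) ⟨
  cutCost (h + 0) h k (k + 0) + 2 * (h * k) + 0
    ≡⟨ cutCost-identity h k 0 ⟩
  2 * squareSum (h + k + 0) + ((h + k) * 0 + 0)
    ≡⟨ cong₂ (λ n r → 2 * squareSum n + (r + 0)) (+-identityʳ (h + k)) (*-zeroʳ (h + k)) ⟩
  2 * squareSum (h + k) + 0
    ≡⟨ +-identityʳ (2 * squareSum (h + k)) ⟩
  2 * squareSum (h + k) ∎
  where open ≡-Reasoning

cutCost-≥ : ∀ b u d → 2 * squareSum (b + u + d) ≤ cutCost (b + d) b u (u + d) + 2 * (b * u)
cutCost-≥ b u d = +-cancelʳ-≤ (2 * squareSum d) _ _ (begin
  2 * squareSum (b + u + d) + 2 * squareSum d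
    ≤⟨ +-monoʳ-≤ (2 * squareSum (b + u + d)) (*-monoʳ-≤ 2 (squareSum≤n*pairs d)) ⟩
  2 * squareSum (b + u + d) + 2 * (d * pairs d)
    ≤⟨ +-monoʳ-≤ (2 * squareSum (b + u + d)) (m≤n+m (2 * (d * pairs d)) ((b + u) * pairs d)) ⟩
  2 * squareSum (b + u + d) + ((b + u) * pairs d + 2 * (d * pairs d))
    ≡⟨ cutCost-identity b u d ⟨
  cutCost (b + d) b u (u + d) + 2 * (b * u) + 2 * squareSum d ∎)
  where open ≤-Reasoning

balance : ℕ → ℕ
balance m = ⌊ m /2⌋ * ⌈ m /2⌉

balance-mono : ∀ {m n} → m ≤ n → balance m ≤ balance n
balance-mono m≤n = *-mono-≤ (⌊n/2⌋-mono m≤n) (⌈n/2⌉-mono m≤n)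

*-≤-balance : ∀ a b → a * b ≤ balance (a + b)
*-≤-balance zero    b       = z≤n
*-≤-balance (suc a) zero    rewrite *-zeroʳ a = z≤n
*-≤-balance (suc a) (suc b) rewrite +-suc a b = begin
  suc a * suc b                ≡⟨ expand a b ⟩
  suc (a + b) + a * b          ≤⟨ +-monoʳ-≤ (suc (a + b)) (*-≤-balance a b) ⟩
  suc (a + b) + f * c          ≡⟨ cong (λ n → suc n + f * c) (⌊n/2⌋+⌈n/2⌉≡n (a + b)) ⟨
  suc (f + c) + f * c          ≡⟨ expand f c ⟨
  suc f * suc c                ∎
  where
  open ≤-Reasoning
  f c : ℕ
  f = ⌊ a + b /2⌋
  c = ⌈ a + b /2⌉
  expand : ∀ a b → suc a * suc b ≡ suc (a + b) + a * b
  expand = solve-∀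

squareSum-≤-cutCost-ordered : ∀ {m} a a′ b b′ → a + a′ ≡ m → b + b′ ≡ m → b ≤ a →
                    2 * squareSum m ≤ cutCost a b a′ b′ + 2 * balance m
squareSum-≤-cutCost-ordered a u b b′ refl b+b′≡a+u b≤a with m≤n⇒∃[o]m+o≡n b≤a
... | d , refl with +-cancelˡ-≡ b b′ (u + d) (trans b+b′≡a+u (regroup b d u))
  where
  regroup : ∀ b d u → b + d + u ≡ b + (u + d)
  regroup = solve-∀
... | refl = begin
  2 * squareSum (b + d + u)
    ≡⟨ cong (λ n → 2 * squareSum n) (regroup b d u) ⟩
  2 * squareSum (b + u + d)
    ≤⟨ cutCost-≥ b u d ⟩
  cutCost (b + d) b u (u + d) + 2 * (b * u)
    ≤⟨ +-monoʳ-≤ (cutCost (b + d) b u (u + d)) (*-monoʳ-≤ 2 (*-≤-balance b u)) ⟩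
  cutCost (b + d) b u (u + d) + 2 * balance (b + u)
    ≤⟨ +-monoʳ-≤ (cutCost (b + d) b u (u + d)) (*-monoʳ-≤ 2 (balance-mono b+u≤m)) ⟩
  cutCost (b + d) b u (u + d) + 2 * balance (b + d + u) ∎
  where
  open ≤-Reasoning
  regroup : ∀ b d u → b + d + u ≡ b + u + d
  regroup = solve-∀
  b+u≤m : b + u ≤ b + d + u
  b+u≤m = +-monoˡ-≤ u (m≤m+n b d)

squareSum-≤-cutCost : ∀ {m} a a′ b b′ → a + a′ ≡ m → b + b′ ≡ m →
                      2 * squareSum m ≤ cutCost a b a′ b′ + 2 * balance m
squareSum-≤-cutCost a a′ b b′ a+a′≡m b+b′≡m with ≤-total b a
... | inj₁ b≤a = squareSum-≤-cutCost-ordered a a′ b b′ a+a′≡m b+b′≡m b≤a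
... | inj₂ a≤b rewrite sideCost-swap a b a′ b′ | sideCost-swap a′ b′ a b =
  squareSum-≤-cutCost-ordered b b′ a a′ b+b′≡m a+a′≡m a≤b

<ᵇ-suc : ∀ {a t} → a ≢ t → (a <ᵇ suc t) ≡ (a <ᵇ t)
<ᵇ-suc {a} {t} a≢t = <ᵇ-cong {a} (λ a<1+t → ≤∧≢⇒< (≤-pred a<1+t) a≢t) m<n⇒m<1+n

below-miss : ∀ {n} {p : Fin n → ℕ} {t} → Avoids p t → below p (suc t) ≡ below p t
below-miss p≢t = sum-cong-≗ λ i → cong [_] (<ᵇ-suc (p≢t i))

below-hit : ∀ {n} {p : Fin n → ℕ} → Injective _≡_ _≡_ p → ∀ k → below p (suc (p k)) ≡ suc (below p (p k))
below-hit {p = p} p-injective k = sum-agree-off k (λ i i≢k → cong [_] (<ᵇ-suc (i≢k ∘ p-injective)))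
  (cong [_] (<ᵇ-true (n<1+n (p k)))) (cong [_] (<ᵇ-false (≤-refl {p k})))

sumBelow : ∀ {n} → (ℕ → ℕ) → (Fin n → ℕ) → ℕ → ℕ
sumBelow {n} f p t = ∑[ i < n ] ([ p i <ᵇ t ] * f (p i))

sumBelow-miss : ∀ {n} f {p : Fin n → ℕ} {t} → Avoids p t → sumBelow f p (suc t) ≡ sumBelow f p t
sumBelow-miss f {p} p≢t = sum-cong-≗ λ i → cong (λ b → [ b ] * f (p i)) (<ᵇ-suc (p≢t i))

sumBelow-hit : ∀ {n} f {p : Fin n → ℕ} → Injective _≡_ _≡_ p → ∀ k →
               sumBelow f p (suc (p k)) ≡ f (p k) + sumBelow f p (p k)
sumBelow-hit f {p} p-injective k = sum-agree-off k
  (λ i i≢k → cong (λ b → [ b ] * f (p i)) (<ᵇ-suc (i≢k ∘ p-injective)))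
  (trans (cong (λ b → [ b ] * f (p k)) (<ᵇ-true (n<1+n (p k)))) (*-identityˡ (f (p k))))
  (cong (λ b → [ b ] * f (p k)) (<ᵇ-false (≤-refl {p k})))

∑-⊓ : ∀ {n} f {p : Fin n → ℕ} {t} → Avoids p t → ∑[ i < n ] f (p i ⊓ t) ≡ sumBelow f p t + above p t * f t
∑-⊓ {n} f {p} {t} p≢t = begin
  ∑[ i < n ] f (p i ⊓ t)
    ≡⟨ sum-cong-≗ (⊓-split f ∘ p≢t) ⟩
  ∑[ i < n ] ([ p i <ᵇ t ] * f (p i) + [ t <ᵇ p i ] * f t)
    ≡⟨ ∑-distrib-+ (λ i → [ p i <ᵇ t ] * f (p i)) (λ i → [ t <ᵇ p i ] * f t) ⟩
  sumBelow f p t + ∑[ i < n ] ([ t <ᵇ p i ] * f t)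
    ≡⟨ cong (sumBelow f p t +_) (*-distribʳ-sum (f t) (λ i → [ t <ᵇ p i ])) ⟨
  sumBelow f p t + above p t * f t ∎
  where open ≡-Reasoning

tracedCost : ∀ {m n} → (Fin m → ℕ) → (Fin n → ℕ) → ℕ → ℕ
tracedCost x y t = sumBelow (pairs ∘ below y) x t + sumBelow (pairs ∘ below x) y t

PathBound : ∀ {m n} → (Fin m → ℕ) → (Fin n → ℕ) → ℕ → Set
PathBound x y t = pathCost (below x t) (below y t) ≤ tracedCost x y t

pathBound-swap : ∀ {m n} (x : Fin m → ℕ) (y : Fin n → ℕ) t → PathBound x y t → PathBound y x t
pathBound-swap x y t = subst₂ _≤_ (pathCost-comm (below x t) (below y t))
                                  (+-comm (sumBelow (pairs ∘ below y) x t) (sumBelow (pairs ∘ below x) y t))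

pathBound-miss : ∀ {m n} {x : Fin m → ℕ} {y : Fin n → ℕ} {t} → Avoids x t → Avoids y t →
                 PathBound x y t → PathBound x y (suc t)
pathBound-miss {x = x} {y} x≢t y≢t = subst₂ _≤_
  (sym (cong₂ pathCost (below-miss x≢t) (below-miss y≢t)))
  (sym (cong₂ _+_ (sumBelow-miss (pairs ∘ below y) x≢t) (sumBelow-miss (pairs ∘ below x) y≢t)))

pathBound-hit : ∀ {m n} {x : Fin m → ℕ} {y : Fin n → ℕ} → Injective _≡_ _≡_ x → ∀ k → Avoids y (x k) →
                PathBound x y (x k) → PathBound x y (suc (x k))
pathBound-hit {x = x} {y} x-injective k y≢t bound = begin
  pathCost (below x (suc t)) (below y (suc t))
    ≡⟨ cong₂ pathCost (below-hit x-injective k) (below-miss y≢t) ⟩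
  pathCost (suc (below x t)) (below y t)
    ≤⟨ pathCost-step (below x t) (below y t) ⟩
  pathCost (below x t) (below y t) + pairs (below y t)
    ≤⟨ +-monoˡ-≤ (pairs (below y t)) bound ⟩
  tracedCost x y t + pairs (below y t)
    ≡⟨ regroup (sumBelow (pairs ∘ below y) x t) (sumBelow (pairs ∘ below x) y t) (pairs (below y t)) ⟩
  pairs (below y t) + sumBelow (pairs ∘ below y) x t + sumBelow (pairs ∘ below x) y t
    ≡⟨ cong₂ _+_ (sumBelow-hit (pairs ∘ below y) x-injective k) (sumBelow-miss (pairs ∘ below x) y≢t) ⟨
  tracedCost x y (suc t) ∎
  where
  open ≤-Reasoning
  t : ℕ
  t = x k
  regroup : ∀ r s c → r + s + c ≡ c + r + s
  regroup = solve-∀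

pathBound : ∀ {m n} {x : Fin m → ℕ} {y : Fin n → ℕ} → Injective _≡_ _≡_ x → Injective _≡_ _≡_ y →
            (∀ i j → x i ≢ y j) → ∀ t → PathBound x y t
pathBound {x = x} {y} x-injective y-injective x≢y zero
  rewrite ∑-zero {f = λ i → [ x i <ᵇ 0 ]} (λ i → cong [_] (<ᵇ-false {x i} z≤n)) = z≤n
pathBound {x = x} {y} x-injective y-injective x≢y (suc t)
  with pathBound x-injective y-injective x≢y t | any? (λ i → x i ≟ t) | any? (λ j → y j ≟ t)
... | bound | yes (i , refl) | _ = pathBound-hit x-injective i (λ j → x≢y i j ∘ sym) bound
... | bound | no _ | yes (j , refl) =
  pathBound-swap y x (suc (y j))
    (pathBound-hit y-injective j (λ i → x≢y i j) (pathBound-swap x y (y j) bound))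
... | bound | no x∌t | no y∌t =
  pathBound-miss (λ i xi≡t → x∌t (i , xi≡t)) (λ j yj≡t → y∌t (j , yj≡t)) bound

-- Two families of positions around a hub

record Distinct {m n} (x : Fin m → ℕ) (y : Fin n → ℕ) (z : ℕ) : Set where
  field
    x-injective : Injective _≡_ _≡_ x
    y-injective : Injective _≡_ _≡_ y
    x≢y         : ∀ i j → x i ≢ y j
    x≢z         : Avoids x z
    y≢z         : Avoids y z

distinct-swap : ∀ {m n} {x : Fin m → ℕ} {y : Fin n → ℕ} {z} → Distinct x y z → Distinct y x z
distinct-swap d = record
  { x-injective = y-injective
  ; y-injective = x-injective
  ; x≢y         = λ j i → x≢y i j ∘ sym
  ; x≢z         = y≢z
  ; y≢z         = x≢z
  }
  where open Distinct d

spokeCrossings : ∀ {m n} → ℕ → (Fin m → ℕ) → (Fin n → ℕ) → ℕ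
spokeCrossings {n = n} z x y = ∑[ j < n ] crossings (y j) z x

hubCrossings : ∀ {m n} → (Fin m → ℕ) → (Fin n → ℕ) → ℕ → ℕ
hubCrossings x y z = spokeCrossings z x y + spokeCrossings z y x

costBelow costAbove : ∀ {m n} → (Fin m → ℕ) → (Fin n → ℕ) → ℕ → ℕ
costBelow {m} {n} x y z = ∑[ j < n ] pairs (below x (y j ⊓ z)) + ∑[ i < m ] pairs (below y (x i ⊓ z))
costAbove {m} {n} x y z = ∑[ j < n ] pairs (above x (y j ⊔ z)) + ∑[ i < m ] pairs (above y (x i ⊔ z))

spokeCrossings-identity : ∀ {m n} {x : Fin m → ℕ} {y : Fin n → ℕ} {z} → Distinct x y z →
  2 * spokeCrossings z x y + (∑[ j < n ] pairs (below x (y j ⊓ z)) + ∑[ j < n ] pairs (above x (y j ⊔ z)))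
  ≡ n * pairs m
spokeCrossings-identity {m} {n} {x} {y} {z} d = begin
  2 * spokeCrossings z x y + (sum belowPairs + sum abovePairs)
    ≡⟨ cong₂ _+_ (*-distribˡ-sum 2 (λ j → crossings (y j) z x)) (sym (∑-distrib-+ belowPairs abovePairs)) ⟩
  ∑[ j < n ] (2 * crossings (y j) z x) + ∑[ j < n ] (belowPairs j + abovePairs j)
    ≡⟨ ∑-distrib-+ (λ j → 2 * crossings (y j) z x) (λ j → belowPairs j + abovePairs j) ⟨
  ∑[ j < n ] (2 * crossings (y j) z x + (belowPairs j + abovePairs j))
    ≡⟨ sum-cong-≗ (λ j → crossings-identity x-injective (λ i → x≢y i j) x≢z (y≢z j)) ⟩
  ∑[ j < n ] pairs m
    ≡⟨ ∑-const n (pairs m) ⟩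
  n * pairs m ∎
  where
  open ≡-Reasoning
  open Distinct d
  belowPairs abovePairs : Fin n → ℕ
  belowPairs j = pairs (below x (y j ⊓ z))
  abovePairs j = pairs (above x (y j ⊔ z))

∑∑-crossings-identity : ∀ {m n} {x : Fin m → ℕ} {y : Fin n → ℕ} →
  Injective _≡_ _≡_ x → Injective _≡_ _≡_ y → (∀ i j → x i ≢ y j) →
  2 * ∑∑ (λ i j → crossings (x i) (x j) y)
    + (∑≠ (λ i j → pairs (below y (x i ⊓ x j))) + ∑≠ (λ i j → pairs (above y (x i ⊔ x j))))
  ≡ pairs m * pairs n
∑∑-crossings-identity {m} {n} {x} {y} x-injective y-injective x≢y = begin
  2 * ∑∑ crossingsAt + (∑≠ belowPairs + ∑≠ abovePairs)
    ≡⟨ cong (λ s → 2 * s + (∑≠ belowPairs + ∑≠ abovePairs)) (∑∑≡∑≠ crossingsAt λ i → crossings-self (x i) y) ⟩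
  2 * ∑≠ crossingsAt + (∑≠ belowPairs + ∑≠ abovePairs)
    ≡⟨ cong₂ _+_ (*-distribˡ-∑≠ 2 crossingsAt) (sym (∑≠-distrib-+ belowPairs abovePairs)) ⟩
  ∑≠ (λ i j → 2 * crossingsAt i j) + ∑≠ (λ i j → belowPairs i j + abovePairs i j)
    ≡⟨ ∑≠-distrib-+ (λ i j → 2 * crossingsAt i j) (λ i j → belowPairs i j + abovePairs i j) ⟨
  ∑≠ (λ i j → 2 * crossingsAt i j + (belowPairs i j + abovePairs i j))
    ≡⟨ ∑≠-cong (λ {i} {j} i≢j → crossings-identity y-injective (avoids i) (avoids j) (i≢j ∘ x-injective)) ⟩
  ∑≠ {m} (λ _ _ → pairs n)
    ≡⟨ ∑≠-const m (pairs n) ⟩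
  pairs m * pairs n ∎
  where
  open ≡-Reasoning
  crossingsAt belowPairs abovePairs : Fin m → Fin m → ℕ
  crossingsAt i j = crossings (x i) (x j) y
  belowPairs i j = pairs (below y (x i ⊓ x j))
  abovePairs i j = pairs (above y (x i ⊔ x j))
  avoids : ∀ i → Avoids y (x i)
  avoids i k = x≢y i k ∘ sym

hubCrossings-identity : ∀ {m n} {x : Fin m → ℕ} {y : Fin n → ℕ} {z} → Distinct x y z →
  2 * hubCrossings x y z + (costBelow x y z + costAbove x y z) ≡ n * pairs m + m * pairs n
hubCrossings-identity {m} {n} {x} {y} {z} d = trans
  (regroup (spokeCrossings z x y) (spokeCrossings z y x)
           (∑[ j < n ] pairs (below x (y j ⊓ z))) (∑[ i < m ] pairs (below y (x i ⊓ z)))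
           (∑[ j < n ] pairs (above x (y j ⊔ z))) (∑[ i < m ] pairs (above y (x i ⊔ z))))
  (cong₂ _+_ (spokeCrossings-identity d) (spokeCrossings-identity (distinct-swap d)))
  where
  regroup : ∀ s t a b a′ b′ → 2 * (s + t) + (a + b + (a′ + b′)) ≡ 2 * s + (a + a′) + (2 * t + (b + b′))
  regroup = solve-∀

sideCost-≤-costBelow : ∀ {m n} {x : Fin m → ℕ} {y : Fin n → ℕ} {z} → Distinct x y z →
  sideCost (below x z) (below y z) (above x z) (above y z) ≤ costBelow x y z
sideCost-≤-costBelow {m} {n} {x} {y} {z} d = begin
  pathCost (below x z) (below y z) + (above y z * pairs (below x z) + above x z * pairs (below y z))
    ≤⟨ +-monoˡ-≤ _ (pathBound x-injective y-injective x≢y z) ⟩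
  tracedCost x y z + (above y z * pairs (below x z) + above x z * pairs (below y z))
    ≡⟨ regroup (sumBelow (pairs ∘ below y) x z) (sumBelow (pairs ∘ below x) y z)
               (above y z * pairs (below x z)) (above x z * pairs (below y z)) ⟩
  sumBelow (pairs ∘ below x) y z + above y z * pairs (below x z)
    + (sumBelow (pairs ∘ below y) x z + above x z * pairs (below y z))
    ≡⟨ cong₂ _+_ (∑-⊓ (pairs ∘ below x) y≢z) (∑-⊓ (pairs ∘ below y) x≢z) ⟨
  costBelow x y z ∎
  where
  open ≤-Reasoning
  open Distinct d
  regroup : ∀ r s a b → r + s + (a + b) ≡ s + a + (r + b)
  regroup = solve-∀

∸-<ᵇ : ∀ {N a b} → a ≤ N → (N ∸ a <ᵇ N ∸ b) ≡ (b <ᵇ a)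
∸-<ᵇ {N} {a} {b} a≤N = <ᵇ-cong {N ∸ a} (λ N∸a<N∸b → ≰⇒> λ a≤b → <⇒≱ N∸a<N∸b (∸-monoʳ-≤ N a≤b))
                                        (λ b<a → ∸-monoʳ-< b<a a≤N)

below-∸ : ∀ {n N} {p : Fin n → ℕ} → (∀ i → p i ≤ N) → ∀ t → below (λ i → N ∸ p i) (N ∸ t) ≡ above p t
below-∸ p≤N t = sum-cong-≗ λ i → cong [_] (∸-<ᵇ (p≤N i))

above-∸ : ∀ {n N t} (p : Fin n → ℕ) → t ≤ N → above (λ i → N ∸ p i) (N ∸ t) ≡ below p t
above-∸ {n} p t≤N = sum-cong-≗ {n} λ i → cong [_] (∸-<ᵇ {b = p i} t≤N)

costBelow-∸ : ∀ {m n N} {x : Fin m → ℕ} {y : Fin n → ℕ} → (∀ i → x i ≤ N) → (∀ j → y j ≤ N) → ∀ z →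
  costBelow (λ i → N ∸ x i) (λ j → N ∸ y j) (N ∸ z) ≡ costAbove x y z
costBelow-∸ {N = N} {x} {y} x≤N y≤N z = cong₂ _+_
  (sum-cong-≗ λ j → cong pairs (below-⊔ x≤N (y j)))
  (sum-cong-≗ λ i → cong pairs (below-⊔ y≤N (x i)))
  where
  below-⊔ : ∀ {n} {p : Fin n → ℕ} → (∀ i → p i ≤ N) → ∀ t →
            below (λ i → N ∸ p i) ((N ∸ t) ⊓ (N ∸ z)) ≡ above p (t ⊔ z)
  below-⊔ {p = p} p≤N t =
    trans (cong (below (λ i → N ∸ p i)) (sym (∸-distribˡ-⊔-⊓ N t z))) (below-∸ p≤N (t ⊔ z))

module _ {m n N} {x : Fin m → ℕ} {y : Fin n → ℕ} {z : ℕ} (d : Distinct x y z)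
         (x≤N : ∀ i → x i ≤ N) (y≤N : ∀ j → y j ≤ N) (z≤N : z ≤ N) where
  open Distinct d

  distinct-∸ : Distinct (λ i → N ∸ x i) (λ j → N ∸ y j) (N ∸ z)
  distinct-∸ = record
    { x-injective = x-injective ∘ ∸-cancelˡ-≡ (x≤N _) (x≤N _)
    ; y-injective = y-injective ∘ ∸-cancelˡ-≡ (y≤N _) (y≤N _)
    ; x≢y         = λ i j → x≢y i j ∘ ∸-cancelˡ-≡ (x≤N i) (y≤N j)
    ; x≢z         = λ i → x≢z i ∘ ∸-cancelˡ-≡ (x≤N i) z≤N
    ; y≢z         = λ j → y≢z j ∘ ∸-cancelˡ-≡ (y≤N j) z≤N
    }

  sideCost-≤-costAbove : sideCost (above x z) (above y z) (below x z) (below y z) ≤ costAbove x y z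
  sideCost-≤-costAbove = subst₂ _≤_ reversed (costBelow-∸ x≤N y≤N z) (sideCost-≤-costBelow distinct-∸)
    where
    reversed : sideCost (below (λ i → N ∸ x i) (N ∸ z)) (below (λ j → N ∸ y j) (N ∸ z))
                        (above (λ i → N ∸ x i) (N ∸ z)) (above (λ j → N ∸ y j) (N ∸ z))
             ≡ sideCost (above x z) (above y z) (below x z) (below y z)
    reversed rewrite below-∸ x≤N z | below-∸ y≤N z | above-∸ x z≤N | above-∸ y z≤N = refl

hubCrossings-≤ : ∀ {m N} {x y : Fin m → ℕ} {z} → Distinct x y z →
  (∀ i → x i ≤ N) → (∀ j → y j ≤ N) → z ≤ N →
  hubCrossings x y z + squareSum m ≤ m * pairs m + balance m
hubCrossings-≤ {m} {N} {x} {y} {z} d x≤N y≤N z≤N = *-cancelˡ-≤ 2 (begin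
  2 * (hubCrossings x y z + squareSum m)
    ≡⟨ *-distribˡ-+ 2 (hubCrossings x y z) (squareSum m) ⟩
  2 * hubCrossings x y z + 2 * squareSum m
    ≤⟨ +-monoʳ-≤ (2 * hubCrossings x y z) (squareSum-≤-cutCost (below x z) (above x z) (below y z) (above y z)
                                             (below+above x≢z) (below+above y≢z)) ⟩
  2 * hubCrossings x y z + (cutCost (below x z) (below y z) (above x z) (above y z) + 2 * balance m)
    ≤⟨ +-monoʳ-≤ (2 * hubCrossings x y z) (+-monoˡ-≤ (2 * balance m)
         (+-mono-≤ (sideCost-≤-costBelow d) (sideCost-≤-costAbove d x≤N y≤N z≤N))) ⟩
  2 * hubCrossings x y z + (costBelow x y z + costAbove x y z + 2 * balance m)
    ≡⟨ +-assoc (2 * hubCrossings x y z) _ (2 * balance m) ⟨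
  2 * hubCrossings x y z + (costBelow x y z + costAbove x y z) + 2 * balance m
    ≡⟨ cong (_+ 2 * balance m) (hubCrossings-identity d) ⟩
  m * pairs m + m * pairs m + 2 * balance m
    ≡⟨ collect (m * pairs m) (balance m) ⟩
  2 * (m * pairs m + balance m) ∎)
  where
  open ≤-Reasoning
  open Distinct d
  collect : ∀ p b → p + p + 2 * b ≡ 2 * (p + b)
  collect = solve-∀

total : ∀ {A : Set} → (A → ℕ) → List A → ℕ
total f L = ∑[ i < length L ] f (lookup L i)

total-cong : ∀ {A : Set} {f g : A → ℕ} → f ≗ g → ∀ L → total f L ≡ total g L
total-cong f≗g L = sum-cong-≗ (f≗g ∘ lookup L)

total-comm : ∀ {A B : Set} (f : A → B → ℕ) L M →
             total (λ a → total (f a) M) L ≡ total (λ b → total (λ a → f a b) L) M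
total-comm f L M = ∑-comm (λ i j → f (lookup L i) (lookup M j))

total-++ : ∀ {A : Set} (f : A → ℕ) L M → total f (L ++ M) ≡ total f L + total f M
total-++ f []      M = refl
total-++ f (a ∷ L) M = trans (cong (f a +_) (total-++ f L M)) (sym (+-assoc (f a) (total f L) (total f M)))

total-map : ∀ {A B : Set} (f : B → ℕ) (g : A → B) L → total f (map g L) ≡ total (f ∘ g) L
total-map f g []      = refl
total-map f g (a ∷ L) = cong (f (g a) +_) (total-map f g L)

total-tabulate : ∀ {A : Set} (f : A → ℕ) {n} (g : Fin n → A) → total f (tabulate g) ≡ sum (f ∘ g)
total-tabulate f {zero}  g = refl
total-tabulate f {suc n} g = cong (f (g zero) +_) (total-tabulate f (g ∘ suc))

total-cartesianProductWith : ∀ {A B C : Set} (f : C → ℕ) (g : A → B → C) L M →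
  total f (cartesianProductWith g L M) ≡ total (λ a → total (f ∘ g a) M) L
total-cartesianProductWith f g []      M = refl
total-cartesianProductWith f g (a ∷ L) M = trans (total-++ f (map (g a) M) (cartesianProductWith g L M))
  (cong₂ _+_ (total-map f (g a) M) (total-cartesianProductWith f g L M))

length-total : ∀ {A : Set} (L : List A) → length L ≡ total (const 1) L
length-total L = sym (trans (∑-const (length L) 1) (*-identityʳ (length L)))

-- Averages over all permutations

permutations : ∀ n → List (Permutation′ n)
permutations zero    = idₚ ∷ []
permutations (suc n) = cartesianProductWith (insert zero) (allFin (suc n)) (permutations n)

total-permutations : ∀ {n} (f : Permutation′ (suc n) → ℕ) →
  total f (permutations (suc n)) ≡ ∑[ j < suc n ] total (f ∘ insert zero j) (permutations n)
total-permutations {n} f = trans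
  (total-cartesianProductWith f (insert zero) (allFin (suc n)) (permutations n))
  (total-tabulate (λ j → total (f ∘ insert zero j) (permutations n)) {suc n} id)

permutations-complete : ∀ {n} (σ : Permutation′ n) → Any (_≈ σ) (permutations n)
permutations-complete {zero}  σ = here λ ()
permutations-complete {suc n} σ = cartesianProductWith⁺ (insert zero) insert-≈
  (∈-allFin (σ ⟨$⟩ʳ zero)) (permutations-complete (remove zero σ))
  where
  insert-≈ : ∀ {j π} → σ ⟨$⟩ʳ zero ≡ j → π ≈ remove zero σ → insert zero j π ≈ σ
  insert-≈ refl π≈ zero    = refl
  insert-≈ refl π≈ (suc i) = trans (cong (punchIn (σ ⟨$⟩ʳ zero)) (π≈ i)) (insert-remove zero σ (suc i))

length-permutations : ∀ n → length (permutations n) ≡ n !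
length-permutations zero    = refl
length-permutations (suc n) = begin
  length (permutations (suc n))
    ≡⟨ length-total (permutations (suc n)) ⟩
  total (const 1) (permutations (suc n))
    ≡⟨ total-permutations {n} (const 1) ⟩
  ∑[ j < suc n ] total (const 1) (permutations n)
    ≡⟨ ∑-const (suc n) (total (const 1) (permutations n)) ⟩
  suc n * total (const 1) (permutations n)
    ≡⟨ cong (suc n *_) (length-total (permutations n)) ⟨
  suc n * length (permutations n)
    ≡⟨ cong (suc n *_) (length-permutations n) ⟩
  suc n * n ! ∎
  where open ≡-Reasoning

total-permutations-const : ∀ n c → total (const c) (permutations n) ≡ n ! * c
total-permutations-const n c = trans (∑-const (length (permutations n)) c)
                                     (cong (_* c) (length-permutations n))

!-suc-* : ∀ n s → n ! * (suc n * s) ≡ suc n ! * s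
!-suc-* n s = trans (sym (*-assoc (n !) (suc n) s)) (cong (_* s) (*-comm (n !) (suc n)))

total-one-point : ∀ {n} (g : Fin (suc n) → ℕ) i →
                  total (λ π → g (π ⟨$⟩ʳ i)) (permutations (suc n)) ≡ n ! * sum g
total-one-point {n} g zero = begin
  total (λ π → g (π ⟨$⟩ʳ zero)) (permutations (suc n))
    ≡⟨ total-permutations {n} (λ π → g (π ⟨$⟩ʳ zero)) ⟩
  ∑[ j < suc n ] total (const (g j)) (permutations n)
    ≡⟨ sum-cong-≗ {suc n} (total-permutations-const n ∘ g) ⟩
  ∑[ j < suc n ] (n ! * g j)
    ≡⟨ *-distribˡ-sum (n !) g ⟨
  n ! * sum g ∎
  where open ≡-Reasoning
total-one-point {suc n} g (suc i) = begin
  total (λ π → g (π ⟨$⟩ʳ suc i)) (permutations (2 + n))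
    ≡⟨ total-permutations {suc n} (λ π → g (π ⟨$⟩ʳ suc i)) ⟩
  ∑[ j < 2 + n ] total (λ π → g (punchIn j (π ⟨$⟩ʳ i))) (permutations (suc n))
    ≡⟨ sum-cong-≗ {2 + n} (λ j → total-one-point (g ∘ punchIn j) i) ⟩
  ∑[ j < 2 + n ] (n ! * ∑[ a < suc n ] g (punchIn j a))
    ≡⟨ *-distribˡ-sum (n !) (λ j → ∑[ a < suc n ] g (punchIn j a)) ⟨
  n ! * ∑[ j < 2 + n ] ∑[ a < suc n ] g (punchIn j a)
    ≡⟨ cong (n ! *_) (∑-punchIn g) ⟩
  n ! * (suc n * sum g)
    ≡⟨ !-suc-* n (sum g) ⟩
  suc n ! * sum g ∎
  where open ≡-Reasoning

total-first-and-other : ∀ {n} (g : Fin (2 + n) → Fin (2 + n) → ℕ) j →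
  total (λ π → g (π ⟨$⟩ʳ zero) (π ⟨$⟩ʳ suc j)) (permutations (2 + n)) ≡ n ! * ∑≠ g
total-first-and-other {n} g j = begin
  total (λ π → g (π ⟨$⟩ʳ zero) (π ⟨$⟩ʳ suc j)) (permutations (2 + n))
    ≡⟨ total-permutations {suc n} (λ π → g (π ⟨$⟩ʳ zero) (π ⟨$⟩ʳ suc j)) ⟩
  ∑[ a < 2 + n ] total (λ π → g a (punchIn a (π ⟨$⟩ʳ j))) (permutations (suc n))
    ≡⟨ sum-cong-≗ {2 + n} (λ a → total-one-point (g a ∘ punchIn a) j) ⟩
  ∑[ a < 2 + n ] (n ! * ∑[ b < suc n ] g a (punchIn a b))
    ≡⟨ *-distribˡ-sum (n !) (λ a → ∑[ b < suc n ] g a (punchIn a b)) ⟨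
  n ! * ∑≠ g ∎
  where open ≡-Reasoning

total-two-points : ∀ {n} (g : Fin (2 + n) → Fin (2 + n) → ℕ) {i j} → i ≢ j →
  total (λ π → g (π ⟨$⟩ʳ i) (π ⟨$⟩ʳ j)) (permutations (2 + n)) ≡ n ! * ∑≠ g
total-two-points         g {zero}     {zero}     0≢0 = contradiction refl 0≢0
total-two-points         g {zero}     {suc j}    _   = total-first-and-other g j
total-two-points {n}     g {suc i}    {zero}     _   =
  trans (total-first-and-other (λ a b → g b a) i) (cong (n ! *_) (sym (∑≠-comm g)))
total-two-points {zero}  g {suc zero} {suc zero} 1≢1 = contradiction refl 1≢1
total-two-points {suc n} g {suc i}    {suc j}    i≢j = begin
  total (λ π → g (π ⟨$⟩ʳ suc i) (π ⟨$⟩ʳ suc j)) (permutations (3 + n))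
    ≡⟨ total-permutations {2 + n} (λ π → g (π ⟨$⟩ʳ suc i) (π ⟨$⟩ʳ suc j)) ⟩
  ∑[ a < 3 + n ] total (λ π → minor a (π ⟨$⟩ʳ i) (π ⟨$⟩ʳ j)) (permutations (2 + n))
    ≡⟨ sum-cong-≗ {3 + n} (λ a → total-two-points (minor a) (i≢j ∘ cong suc)) ⟩
  ∑[ a < 3 + n ] (n ! * ∑≠ (minor a))
    ≡⟨ *-distribˡ-sum (n !) (∑≠ ∘ minor) ⟨
  n ! * ∑[ a < 3 + n ] ∑≠ (minor a)
    ≡⟨ cong (n ! *_) (∑≠-punchIn g) ⟩
  n ! * (suc n * ∑≠ g)
    ≡⟨ !-suc-* n (∑≠ g) ⟩
  suc n ! * ∑≠ g ∎
  where
  open ≡-Reasoning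
  minor : Fin (3 + n) → Fin (2 + n) → Fin (2 + n) → ℕ
  minor a b c = g (punchIn a b) (punchIn a c)

total-three-points : ∀ {n} (let P = permutations (2 + n))
  (g : Fin (2 + n) → Fin (2 + n) → Fin (2 + n) → ℕ) {i k} j → i ≢ k →
  total (λ σ → total (λ τ → g (τ ⟨$⟩ʳ j) (σ ⟨$⟩ʳ i) (σ ⟨$⟩ʳ k)) P) P
  ≡ n ! * suc n ! * ∑≠ (λ p q → ∑[ r < 2 + n ] g r p q)
total-three-points {n} g {i} {k} j i≢k = begin
  total (λ σ → total (λ τ → g (τ ⟨$⟩ʳ j) (σ ⟨$⟩ʳ i) (σ ⟨$⟩ʳ k)) P) P
    ≡⟨ total-cong (λ σ → total-one-point (λ r → g r (σ ⟨$⟩ʳ i) (σ ⟨$⟩ʳ k)) j) P ⟩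
  total (λ σ → suc n ! * G (σ ⟨$⟩ʳ i) (σ ⟨$⟩ʳ k)) P
    ≡⟨ total-two-points (λ p q → suc n ! * G p q) i≢k ⟩
  n ! * ∑≠ (λ p q → suc n ! * G p q)
    ≡⟨ cong (n ! *_) (*-distribˡ-∑≠ (suc n !) G) ⟨
  n ! * (suc n ! * ∑≠ G)
    ≡⟨ *-assoc (n !) (suc n !) (∑≠ G) ⟨
  n ! * suc n ! * ∑≠ G ∎
  where
  open ≡-Reasoning
  P : List (Permutation′ (2 + n))
  P = permutations (2 + n)
  G : Fin (2 + n) → Fin (2 + n) → ℕ
  G p q = ∑[ r < 2 + n ] g r p q

total-four-points : ∀ {n} (let P = permutations (2 + n))
  (g : Fin (2 + n) → Fin (2 + n) → Fin (2 + n) → Fin (2 + n) → ℕ) {i j k l} → i ≢ j → k ≢ l →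
  total (λ σ → total (λ τ → g (σ ⟨$⟩ʳ i) (σ ⟨$⟩ʳ j) (τ ⟨$⟩ʳ k) (τ ⟨$⟩ʳ l)) P) P
  ≡ n ! * n ! * ∑≠ (λ p q → ∑≠ (g p q))
total-four-points {n} g {i} {j} {k} {l} i≢j k≢l = begin
  total (λ σ → total (λ τ → g (σ ⟨$⟩ʳ i) (σ ⟨$⟩ʳ j) (τ ⟨$⟩ʳ k) (τ ⟨$⟩ʳ l)) P) P
    ≡⟨ total-cong (λ σ → total-two-points (g (σ ⟨$⟩ʳ i) (σ ⟨$⟩ʳ j)) k≢l) P ⟩
  total (λ σ → n ! * ∑≠ (g (σ ⟨$⟩ʳ i) (σ ⟨$⟩ʳ j))) P
    ≡⟨ total-two-points (λ p q → n ! * ∑≠ (g p q)) i≢j ⟩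
  n ! * ∑≠ (λ p q → n ! * ∑≠ (g p q))
    ≡⟨ cong (n ! *_) (*-distribˡ-∑≠ (n !) (λ p q → ∑≠ (g p q))) ⟨
  n ! * (n ! * ∑≠ (λ p q → ∑≠ (g p q)))
    ≡⟨ *-assoc (n !) (n !) (∑≠ (λ p q → ∑≠ (g p q))) ⟨
  n ! * n ! * ∑≠ (λ p q → ∑≠ (g p q)) ∎
  where
  open ≡-Reasoning
  P : List (Permutation′ (2 + n))
  P = permutations (2 + n)

-- Vertices and edges of K_{1,m,m}

module _ {m : ℕ} where

  private
    V : Set
    V = Fin (1 + m + m)

  vertex : Fin m ⊎ Fin m → V
  vertex s = suc (join m m s)

  xᵛ yᵛ : Fin m → V
  xᵛ i = vertex (inj₁ i)
  yᵛ j = vertex (inj₂ j)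

  vertex-elim : (Q : V → Set) → Q zero → (∀ i → Q (xᵛ i)) → (∀ j → Q (yᵛ j)) → ∀ v → Q v
  vertex-elim Q qz qx qy zero = qz
  vertex-elim Q qz qx qy (suc w) with splitAt m w | join-splitAt m m w
  ... | inj₁ i | refl = qx i
  ... | inj₂ j | refl = qy j

  part-x : ∀ i → part m (xᵛ i) ≡ 1
  part-x i rewrite toℕ-↑ˡ i m | <ᵇ-true (toℕ<n i) = refl

  part-y : ∀ j → part m (yᵛ j) ≡ 2
  part-y j rewrite toℕ-↑ʳ m j | <ᵇ-false (m≤m+n m (toℕ j)) = refl

  zx-adjacent : ∀ i → Adj m zero (xᵛ i)
  zx-adjacent i rewrite part-x i = λ ()

  zy-adjacent : ∀ j → Adj m zero (yᵛ j)
  zy-adjacent j rewrite part-y j = λ ()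

  xy-adjacent : ∀ i j → Adj m (xᵛ i) (yᵛ j)
  xy-adjacent i j rewrite part-x i | part-y j = λ ()

  xᵛ≢yᵛ : ∀ i j → xᵛ i ≢ yᵛ j
  xᵛ≢yᵛ i j = xy-adjacent i j ∘ cong (part m)

  xᵛ-injective : Injective _≡_ _≡_ xᵛ
  xᵛ-injective {i} {j} = ↑ˡ-injective m i j ∘ suc-injectiveᶠ

  yᵛ-injective : Injective _≡_ _≡_ yᵛ
  yᵛ-injective {i} {j} = ↑ʳ-injective m i j ∘ suc-injectiveᶠ

  edge-elim : (Q : V → V → Set) → (∀ {a b} → Q a b → Q b a) →
              (∀ i → Q zero (xᵛ i)) → (∀ j → Q zero (yᵛ j)) → (∀ i j → Q (xᵛ i) (yᵛ j)) →
              ∀ a b → Adj m a b → Q a b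
  edge-elim Q Q-sym zx zy xy = vertex-elim _
    (vertex-elim _ (contradiction refl) (λ i _ → zx i) (λ j _ → zy j))
    (λ i → vertex-elim _ (λ _ → Q-sym (zx i)) (λ k → contradiction (same-part part-x i k))
                         (λ j _ → xy i j))
    (λ j → vertex-elim _ (λ _ → Q-sym (zy j)) (λ i _ → Q-sym (xy i j))
                         (λ k → contradiction (same-part part-y j k)))
    where
    same-part : ∀ {v : Fin m → V} {p} → (∀ i → part m (v i) ≡ p) → ∀ i k → part m (v i) ≡ part m (v k)
    same-part part-v i k = trans (part-v i) (sym (part-v k))

  module _ (Q : V → V → V → V → Set)
           (Q-flipˡ : ∀ {a b c d} → Q a b c d → Q b a c d) (Q-swap : ∀ {a b c d} → Q a b c d → Q c d a b)
           (yx-zx : ∀ {i k} j → i ≢ k → Q (yᵛ j) (xᵛ i) zero (xᵛ k))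
           (xy-zy : ∀ {i k} j → i ≢ k → Q (xᵛ j) (yᵛ i) zero (yᵛ k))
           (xy-xy : ∀ {i j k l} → i ≢ j → k ≢ l → Q (xᵛ i) (yᵛ k) (xᵛ j) (yᵛ l)) where

    private
      Disjoint : V → V → V → V → Set
      Disjoint a b c d = (a ≢ c) × (a ≢ d) × (b ≢ c) × (b ≢ d)

      Q-flipʳ : ∀ {a b c d} → Q a b c d → Q a b d c
      Q-flipʳ = Q-swap ∘ Q-flipˡ ∘ Q-swap

      Holds : V → V → V → V → Set
      Holds a b c d = Disjoint a b c d → Q a b c d

      second-edge-elim : ∀ a b → (∀ i → Holds a b zero (xᵛ i)) → (∀ j → Holds a b zero (yᵛ j)) →
                         (∀ i j → Holds a b (xᵛ i) (yᵛ j)) → ∀ c d → Adj m c d → Holds a b c d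
      second-edge-elim a b = edge-elim (Holds a b)
        λ q (a≢d , a≢c , b≢d , b≢c) → Q-flipʳ (q (a≢c , a≢d , b≢c , b≢d))

    nonincident-elim : ∀ a b c d → NonincidentPair m a b c d → Q a b c d
    nonincident-elim a b c d (ab , cd , disjoint) = edge-elim (λ a b → ∀ c d → Adj m c d → Holds a b c d)
      (λ q c d cd (b≢c , b≢d , a≢c , a≢d) → Q-flipˡ (q c d cd (a≢c , a≢d , b≢c , b≢d)))
      (λ i → second-edge-elim zero (xᵛ i)
        (λ _ (z≢z , _) → contradiction refl z≢z)
        (λ _ (z≢z , _) → contradiction refl z≢z)
        (λ k j (_ , _ , xi≢xk , _) → Q-swap (Q-flipˡ (yx-zx j (xi≢xk ∘ sym ∘ cong xᵛ)))))
      (λ i → second-edge-elim zero (yᵛ i)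
        (λ _ (z≢z , _) → contradiction refl z≢z)
        (λ _ (z≢z , _) → contradiction refl z≢z)
        (λ j k (_ , _ , _ , yi≢yk) → Q-swap (xy-zy j (yi≢yk ∘ sym ∘ cong yᵛ))))
      (λ i k → second-edge-elim (xᵛ i) (yᵛ k)
        (λ j (_ , xi≢xj , _) → Q-flipˡ (yx-zx k (xi≢xj ∘ cong xᵛ)))
        (λ l (_ , _ , _ , yk≢yl) → xy-zy i (yk≢yl ∘ cong yᵛ))
        (λ j l (xi≢xj , _ , _ , yk≢yl) → xy-xy (xi≢xj ∘ cong xᵛ) (yk≢yl ∘ cong yᵛ)))
      a b ab c d cd disjoint

posᶻ : ∀ m → LinOrd (1 + m + m) → ℕ
posᶻ m ρ = pos ρ zero

posˣ posʸ : ∀ m → LinOrd (1 + m + m) → Fin m → ℕ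
posˣ m ρ i = pos ρ (xᵛ i)
posʸ m ρ j = pos ρ (yᵛ j)

pos-injective : ∀ {n} (ρ : LinOrd n) → Injective _≡_ _≡_ (pos ρ)
pos-injective ρ = Injection.injective (↔⇒↣ ρ) ∘ toℕ-injective

pos-≤ : ∀ {n} (ρ : LinOrd (suc n)) v → pos ρ v ≤ n
pos-≤ ρ v = ≤-pred (toℕ<n (ρ ⟨$⟩ʳ v))

pos-distinct : ∀ m ρ → Distinct (posˣ m ρ) (posʸ m ρ) (posᶻ m ρ)
pos-distinct m ρ = record
  { x-injective = xᵛ-injective ∘ pos-injective ρ
  ; y-injective = yᵛ-injective ∘ pos-injective ρ
  ; x≢y         = λ i j → xᵛ≢yᵛ i j ∘ pos-injective ρ
  ; x≢z         = λ i xi≡z → contradiction (pos-injective ρ xi≡z) λ ()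
  ; y≢z         = λ j yj≡z → contradiction (pos-injective ρ yj≡z) λ ()
  }

spokeSeparationsˣ spokeSeparationsʸ hubSeparations rimSeparations : ∀ m → LinOrd (1 + m + m) → ℕ
spokeSeparationsˣ m ρ = spokeCrossings (posᶻ m ρ) (posˣ m ρ) (posʸ m ρ)
spokeSeparationsʸ m ρ = spokeCrossings (posᶻ m ρ) (posʸ m ρ) (posˣ m ρ)
hubSeparations m ρ = hubCrossings (posˣ m ρ) (posʸ m ρ) (posᶻ m ρ)
rimSeparations m ρ = ∑∑ λ i j → crossings (posˣ m ρ i) (posˣ m ρ j) (posʸ m ρ)

hubSeparations-≤ : ∀ m ρ → hubSeparations m ρ + squareSum m ≤ m * pairs m + balance m
hubSeparations-≤ m ρ = hubCrossings-≤ (pos-distinct m ρ) (pos-≤ ρ ∘ xᵛ) (pos-≤ ρ ∘ yᵛ) (pos-≤ ρ zero)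

-- The lower bound

countSep-total : ∀ {n} (L : List (LinOrd n)) a b c d →
                 countSep L a b c d ≡ total (λ ρ → [ separates ρ a b c d ]) L
countSep-total []      a b c d = refl
countSep-total (ρ ∷ L) a b c d = cong ([ separates ρ a b c d ] +_) (countSep-total L a b c d)

tSeparating⇒spokeCrossings : ∀ {m t} (u v : Fin m → Fin (1 + m + m)) →
  (∀ {i k} j → i ≢ k → NonincidentPair m (v j) (u i) zero (u k)) →
  (L : List (LinOrd (1 + m + m))) → TSeparating m t L →
  m * (pairs m * t) ≤ total (λ ρ → spokeCrossings (pos ρ zero) (pos ρ ∘ u) (pos ρ ∘ v)) L
tSeparating⇒spokeCrossings {m} {t} u v nonincident L separating = begin
  m * (pairs m * t)                                   ≡⟨ ∑-const m (pairs m * t) ⟨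
  ∑[ j < m ] (pairs m * t)                            ≤⟨ ∑-mono atHub ⟩
  ∑[ j < m ] total (λ ρ → crossings (pos ρ (v j)) (pos ρ zero) (pos ρ ∘ u)) L
    ≡⟨ ∑-comm (λ j l → crossings (pos (lookup L l) (v j)) (pos (lookup L l) zero) (pos (lookup L l) ∘ u)) ⟩
  total (λ ρ → spokeCrossings (pos ρ zero) (pos ρ ∘ u) (pos ρ ∘ v)) L ∎
  where
  open ≤-Reasoning
  atHub : ∀ j → pairs m * t ≤ total (λ ρ → crossings (pos ρ (v j)) (pos ρ zero) (pos ρ ∘ u)) L
  atHub j = begin
    pairs m * t
      ≡⟨ ∑≠-const m t ⟨
    ∑≠ {m} (λ _ _ → t)
      ≤⟨ ∑≠-mono (λ {i} {k} i≢k → separating (v j) (u i) zero (u k) (nonincident j i≢k)) ⟩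
    ∑≠ (λ i k → countSep L (v j) (u i) zero (u k))
      ≤⟨ m≤n+m _ _ ⟩
    ∑[ i < m ] countSep L (v j) (u i) zero (u i) + ∑≠ (λ i k → countSep L (v j) (u i) zero (u k))
      ≡⟨ ∑∑-diagonal (λ i k → countSep L (v j) (u i) zero (u k)) ⟨
    ∑∑ (λ i k → countSep L (v j) (u i) zero (u k))
      ≡⟨ ∑∑-cong (λ i k → countSep-total L (v j) (u i) zero (u k)) ⟩
    ∑∑ (λ i k → total (λ ρ → [ separates ρ (v j) (u i) zero (u k) ]) L)
      ≡⟨ ∑∑-∑-comm (λ l i k → [ separates (lookup L l) (v j) (u i) zero (u k) ]) ⟩
    total (λ ρ → crossings (pos ρ (v j)) (pos ρ zero) (pos ρ ∘ u)) L ∎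

tSeparating⇒hubSeparations : ∀ {m t} (L : List (LinOrd (1 + m + m))) → TSeparating m t L →
  2 * (m * pairs m) * t ≤ total (hubSeparations m) L
tSeparating⇒hubSeparations {m} {t} L separating = begin
  2 * (m * pairs m) * t
    ≡⟨ distribute m (pairs m) t ⟩
  m * (pairs m * t) + m * (pairs m * t)
    ≤⟨ +-mono-≤ (tSeparating⇒spokeCrossings xᵛ yᵛ yx-zx L separating)
                (tSeparating⇒spokeCrossings yᵛ xᵛ xy-zy L separating) ⟩
  total (spokeSeparationsˣ m) L + total (spokeSeparationsʸ m) L
    ≡⟨ ∑-distrib-+ (spokeSeparationsˣ m ∘ lookup L) (spokeSeparationsʸ m ∘ lookup L) ⟨
  total (hubSeparations m) L ∎
  where
  open ≤-Reasoning
  distribute : ∀ m p t → 2 * (m * p) * t ≡ m * (p * t) + m * (p * t)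
  distribute = solve-∀
  yx-zx : ∀ {i k} j → i ≢ k → NonincidentPair m (yᵛ j) (xᵛ i) zero (xᵛ k)
  yx-zx {i} {k} j i≢k =
    xy-adjacent i j ∘ sym , zx-adjacent k , (λ ()) , xᵛ≢yᵛ k j ∘ sym , (λ ()) , i≢k ∘ xᵛ-injective
  xy-zy : ∀ {i k} j → i ≢ k → NonincidentPair m (xᵛ j) (yᵛ i) zero (yᵛ k)
  xy-zy {i} {k} j i≢k =
    xy-adjacent j i , zy-adjacent k , (λ ()) , xᵛ≢yᵛ j k , (λ ()) , i≢k ∘ yᵛ-injective

-- The symmetrised family

onParts : ∀ {m} → (Fin m ⊎ Fin m) ↔ (Fin m ⊎ Fin m) → Permutation′ (1 + m + m)
onParts π = lift₀ (↔-trans +↔⊎ (↔-trans π (↔-sym +↔⊎)))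

onParts-vertex : ∀ {m} (π : (Fin m ⊎ Fin m) ↔ (Fin m ⊎ Fin m)) s →
                 onParts π ⟨$⟩ʳ vertex s ≡ vertex (Inverse.to π s)
onParts-vertex {m} π s = cong (vertex ∘ Inverse.to π) (splitAt-join m m s)

relabel : ∀ {m} → Permutation′ m → Permutation′ m → Permutation′ (1 + m + m)
relabel σ τ = onParts (σ ⊎-↔ τ)

exchange : ∀ m → Permutation′ (1 + m + m)
exchange m = onParts (⊎-comm (Fin m) (Fin m))

posˣ-relabel : ∀ {m} (σ τ : Permutation′ m) ρ → posˣ m (relabel σ τ ∘ₚ ρ) ≗ posˣ m ρ ∘ (σ ⟨$⟩ʳ_)
posˣ-relabel σ τ ρ i = cong (pos ρ) (onParts-vertex (σ ⊎-↔ τ) (inj₁ i))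

posʸ-relabel : ∀ {m} (σ τ : Permutation′ m) ρ → posʸ m (relabel σ τ ∘ₚ ρ) ≗ posʸ m ρ ∘ (τ ⟨$⟩ʳ_)
posʸ-relabel σ τ ρ j = cong (pos ρ) (onParts-vertex (σ ⊎-↔ τ) (inj₂ j))

posˣ-exchange : ∀ m ρ → posˣ m (exchange m ∘ₚ ρ) ≗ posʸ m ρ
posˣ-exchange m ρ i = cong (pos ρ) (onParts-vertex (⊎-comm (Fin m) (Fin m)) (inj₁ i))

posʸ-exchange : ∀ m ρ → posʸ m (exchange m ∘ₚ ρ) ≗ posˣ m ρ
posʸ-exchange m ρ j = cong (pos ρ) (onParts-vertex (⊎-comm (Fin m) (Fin m)) (inj₂ j))

relabellings orbit : ∀ m → LinOrd (1 + m + m) → List (LinOrd (1 + m + m))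
relabellings m ρ = cartesianProductWith (λ σ τ → relabel σ τ ∘ₚ ρ) (permutations m) (permutations m)
orbit m ρ = relabellings m ρ ++ relabellings m (exchange m ∘ₚ ρ)

length-relabellings : ∀ m (ρ : LinOrd (1 + m + m)) → length (relabellings m ρ) ≡ m ! * m !
length-relabellings m ρ = begin
  length (relabellings m ρ)
    ≡⟨ length-total (relabellings m ρ) ⟩
  total (const 1) (relabellings m ρ)
    ≡⟨ total-cartesianProductWith (const 1) (λ σ τ → relabel σ τ ∘ₚ ρ) (permutations m) (permutations m) ⟩
  total (λ _ → total (const 1) (permutations m)) (permutations m)
    ≡⟨ total-permutations-const m (total (const 1) (permutations m)) ⟩
  m ! * total (const 1) (permutations m)
    ≡⟨ cong (m ! *_) (trans (total-permutations-const m 1) (*-identityʳ (m !))) ⟩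
  m ! * m ! ∎
  where open ≡-Reasoning

length-orbit : ∀ m (ρ : LinOrd (1 + m + m)) → length (orbit m ρ) ≡ 2 * (m ! * m !)
length-orbit m ρ = begin
  length (orbit m ρ)
    ≡⟨ length-++ (relabellings m ρ) ⟩
  length (relabellings m ρ) + length (relabellings m (exchange m ∘ₚ ρ))
    ≡⟨ cong₂ _+_ (length-relabellings m ρ) (length-relabellings m (exchange m ∘ₚ ρ)) ⟩
  m ! * m ! + m ! * m !
    ≡⟨ cong (m ! * m ! +_) (+-identityʳ (m ! * m !)) ⟨
  2 * (m ! * m !) ∎
  where open ≡-Reasoning

countSep-relabellings : ∀ m (ρ : LinOrd (1 + m + m)) a b c d (let P = permutations m) →
  countSep (relabellings m ρ) a b c d ≡ total (λ σ → total (λ τ → [ separates (relabel σ τ ∘ₚ ρ) a b c d ]) P) P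
countSep-relabellings m ρ a b c d = trans (countSep-total (relabellings m ρ) a b c d)
  (total-cartesianProductWith (λ π → [ separates π a b c d ]) (λ σ τ → relabel σ τ ∘ₚ ρ)
                              (permutations m) (permutations m))

∑≠-∑-sep : ∀ {n o} (u : Fin o → ℕ) v (p : Fin n → ℕ) →
           ∑≠ (λ i j → ∑[ k < o ] [ sep (u k) (p i) v (p j) ]) ≡ ∑[ k < o ] crossings (u k) v p
∑≠-∑-sep {o = o} u v p = begin
  ∑≠ (λ i j → ∑[ k < o ] [ sep (u k) (p i) v (p j) ])
    ≡⟨ ∑∑≡∑≠ _ incident ⟨
  ∑∑ (λ i j → ∑[ k < o ] [ sep (u k) (p i) v (p j) ])
    ≡⟨ ∑∑-∑-comm (λ k i j → [ sep (u k) (p i) v (p j) ]) ⟩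
  ∑[ k < o ] crossings (u k) v p ∎
  where
  open ≡-Reasoning
  incident : ∀ i → ∑[ k < o ] [ sep (u k) (p i) v (p i) ] ≡ 0
  incident i = ∑-zero λ k → cong [_] (sep-incidentʳ (u k) (p i) v)

∑≠-∑≠-sep : ∀ {m n} (p : Fin m → ℕ) (q : Fin n → ℕ) →
            ∑≠ (λ i j → ∑≠ (λ k l → [ sep (p i) (q k) (p j) (q l) ])) ≡ ∑∑ (λ i j → crossings (p i) (p j) q)
∑≠-∑≠-sep {m} p q = begin
  ∑≠ (λ i j → ∑≠ (λ k l → [ sep (p i) (q k) (p j) (q l) ]))
    ≡⟨ ∑≠-cong {m} (λ {i} {j} _ → ∑∑≡∑≠ _ (incident i j)) ⟨
  ∑≠ (λ i j → crossings (p i) (p j) q)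
    ≡⟨ ∑∑≡∑≠ _ (λ i → crossings-self (p i) q) ⟨
  ∑∑ (λ i j → crossings (p i) (p j) q) ∎
  where
  open ≡-Reasoning
  incident : ∀ i j k → [ sep (p i) (q k) (p j) (q k) ] ≡ 0
  incident i j k = cong [_] (sep-incidentʳ (p i) (q k) (p j))

module _ {n : ℕ} (ρ : LinOrd (1 + (2 + n) + (2 + n))) where

  private
    m : ℕ
    m = 2 + n

    P : List (Permutation′ m)
    P = permutations m

    x y : Fin m → ℕ
    x = posˣ m ρ
    y = posʸ m ρ

    z : ℕ
    z = posᶻ m ρ

    x-relabel : ∀ σ τ i → posˣ m (relabel σ τ ∘ₚ ρ) i ≡ x (σ ⟨$⟩ʳ i)
    x-relabel σ τ = posˣ-relabel σ τ ρ

    y-relabel : ∀ σ τ j → posʸ m (relabel σ τ ∘ₚ ρ) j ≡ y (τ ⟨$⟩ʳ j)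
    y-relabel σ τ = posʸ-relabel σ τ ρ

    total-total-cong : ∀ {f g : Permutation′ m → Permutation′ m → ℕ} → (∀ σ τ → f σ τ ≡ g σ τ) →
                       total (λ σ → total (f σ) P) P ≡ total (λ σ → total (g σ) P) P
    total-total-cong f≡g = total-cong (λ σ → total-cong (f≡g σ) P) P

  countSep-relabellings-yx-zx : ∀ {i k} j → i ≢ k →
    countSep (relabellings m ρ) (yᵛ j) (xᵛ i) zero (xᵛ k) ≡ n ! * suc n ! * spokeSeparationsˣ m ρ
  countSep-relabellings-yx-zx {i} {k} j i≢k = begin
    countSep (relabellings m ρ) (yᵛ j) (xᵛ i) zero (xᵛ k)
      ≡⟨ countSep-relabellings m ρ (yᵛ j) (xᵛ i) zero (xᵛ k) ⟩
    total (λ σ → total (λ τ → [ separates (relabel σ τ ∘ₚ ρ) (yᵛ j) (xᵛ i) zero (xᵛ k) ]) P) P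
      ≡⟨ total-total-cong (λ σ τ → cong [_]
           (sep-cong (y-relabel σ τ j) (x-relabel σ τ i) (refl {x = z}) (x-relabel σ τ k))) ⟩
    total (λ σ → total (λ τ → [ sep (y (τ ⟨$⟩ʳ j)) (x (σ ⟨$⟩ʳ i)) z (x (σ ⟨$⟩ʳ k)) ]) P) P
      ≡⟨ total-three-points (λ r p q → [ sep (y r) (x p) z (x q) ]) j i≢k ⟩
    n ! * suc n ! * ∑≠ (λ p q → ∑[ r < m ] [ sep (y r) (x p) z (x q) ])
      ≡⟨ cong (n ! * suc n ! *_) (∑≠-∑-sep y z x) ⟩
    n ! * suc n ! * spokeSeparationsˣ m ρ ∎
    where open ≡-Reasoning

  countSep-relabellings-xy-zy : ∀ {i k} j → i ≢ k →
    countSep (relabellings m ρ) (xᵛ j) (yᵛ i) zero (yᵛ k) ≡ n ! * suc n ! * spokeSeparationsʸ m ρ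
  countSep-relabellings-xy-zy {i} {k} j i≢k = begin
    countSep (relabellings m ρ) (xᵛ j) (yᵛ i) zero (yᵛ k)
      ≡⟨ countSep-relabellings m ρ (xᵛ j) (yᵛ i) zero (yᵛ k) ⟩
    total (λ σ → total (λ τ → [ separates (relabel σ τ ∘ₚ ρ) (xᵛ j) (yᵛ i) zero (yᵛ k) ]) P) P
      ≡⟨ total-total-cong (λ σ τ → cong [_]
           (sep-cong (x-relabel σ τ j) (y-relabel σ τ i) (refl {x = z}) (y-relabel σ τ k))) ⟩
    total (λ σ → total (λ τ → [ sep (x (σ ⟨$⟩ʳ j)) (y (τ ⟨$⟩ʳ i)) z (y (τ ⟨$⟩ʳ k)) ]) P) P
      ≡⟨ total-comm (λ σ τ → [ sep (x (σ ⟨$⟩ʳ j)) (y (τ ⟨$⟩ʳ i)) z (y (τ ⟨$⟩ʳ k)) ]) P P ⟩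
    total (λ τ → total (λ σ → [ sep (x (σ ⟨$⟩ʳ j)) (y (τ ⟨$⟩ʳ i)) z (y (τ ⟨$⟩ʳ k)) ]) P) P
      ≡⟨ total-three-points (λ r p q → [ sep (x r) (y p) z (y q) ]) j i≢k ⟩
    n ! * suc n ! * ∑≠ (λ p q → ∑[ r < m ] [ sep (x r) (y p) z (y q) ])
      ≡⟨ cong (n ! * suc n ! *_) (∑≠-∑-sep x z y) ⟩
    n ! * suc n ! * spokeSeparationsʸ m ρ ∎
    where open ≡-Reasoning

  countSep-relabellings-xy-xy : ∀ {i j k l} → i ≢ j → k ≢ l →
    countSep (relabellings m ρ) (xᵛ i) (yᵛ k) (xᵛ j) (yᵛ l) ≡ n ! * n ! * rimSeparations m ρ
  countSep-relabellings-xy-xy {i} {j} {k} {l} i≢j k≢l = begin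
    countSep (relabellings m ρ) (xᵛ i) (yᵛ k) (xᵛ j) (yᵛ l)
      ≡⟨ countSep-relabellings m ρ (xᵛ i) (yᵛ k) (xᵛ j) (yᵛ l) ⟩
    total (λ σ → total (λ τ → [ separates (relabel σ τ ∘ₚ ρ) (xᵛ i) (yᵛ k) (xᵛ j) (yᵛ l) ]) P) P
      ≡⟨ total-total-cong (λ σ τ → cong [_]
           (sep-cong (x-relabel σ τ i) (y-relabel σ τ k) (x-relabel σ τ j) (y-relabel σ τ l))) ⟩
    total (λ σ → total (λ τ → [ sep (x (σ ⟨$⟩ʳ i)) (y (τ ⟨$⟩ʳ k)) (x (σ ⟨$⟩ʳ j)) (y (τ ⟨$⟩ʳ l)) ]) P) P
      ≡⟨ total-four-points (λ p q r s → [ sep (x p) (y r) (x q) (y s) ]) i≢j k≢l ⟩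
    n ! * n ! * ∑≠ (λ p q → ∑≠ (λ r s → [ sep (x p) (y r) (x q) (y s) ]))
      ≡⟨ cong (n ! * n ! *_) (∑≠-∑≠-sep x y) ⟩
    n ! * n ! * rimSeparations m ρ ∎
    where open ≡-Reasoning

spokeSeparationsˣ-exchange : ∀ m ρ → spokeSeparationsˣ m (exchange m ∘ₚ ρ) ≡ spokeSeparationsʸ m ρ
spokeSeparationsˣ-exchange m ρ =
  sum-cong-≗ λ j → crossings-cong (posʸ-exchange m ρ j) refl (posˣ-exchange m ρ)

spokeSeparationsʸ-exchange : ∀ m ρ → spokeSeparationsʸ m (exchange m ∘ₚ ρ) ≡ spokeSeparationsˣ m ρ
spokeSeparationsʸ-exchange m ρ =
  sum-cong-≗ λ j → crossings-cong (posˣ-exchange m ρ j) refl (posʸ-exchange m ρ)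

rimSeparations-exchange : ∀ m ρ → rimSeparations m (exchange m ∘ₚ ρ) ≡ rimSeparations m ρ
rimSeparations-exchange m ρ = trans
  (∑∑-cong λ i j → crossings-cong (posˣ-exchange m ρ i) (posˣ-exchange m ρ j) (posʸ-exchange m ρ))
  (∑∑-crossings-comm (posʸ m ρ) (posˣ m ρ))

countSep-++ : ∀ {n} (L M : List (LinOrd n)) a b c d →
              countSep (L ++ M) a b c d ≡ countSep L a b c d + countSep M a b c d
countSep-++ []      M a b c d = refl
countSep-++ (ρ ∷ L) M a b c d = trans
  (cong ([ separates ρ a b c d ] +_) (countSep-++ L M a b c d))
  (sym (+-assoc [ separates ρ a b c d ] (countSep L a b c d) (countSep M a b c d)))

countSep-cong : ∀ {n} {a b c d a′ b′ c′ d′ : Fin n} →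
                (∀ ρ → separates ρ a b c d ≡ separates ρ a′ b′ c′ d′) →
                ∀ L → countSep L a b c d ≡ countSep L a′ b′ c′ d′
countSep-cong same []      = refl
countSep-cong same (ρ ∷ L) = cong₂ (λ s t → [ s ] + t) (same ρ) (countSep-cong same L)

countSep-orbit : ∀ m {a b c d} w (f : LinOrd (1 + m + m) → ℕ) →
  (∀ ρ → countSep (relabellings m ρ) a b c d ≡ w * f ρ) →
  ∀ ρ → countSep (orbit m ρ) a b c d ≡ w * (f ρ + f (exchange m ∘ₚ ρ))
countSep-orbit m {a} {b} {c} {d} w f counted ρ = begin
  countSep (orbit m ρ) a b c d
    ≡⟨ countSep-++ (relabellings m ρ) (relabellings m (exchange m ∘ₚ ρ)) a b c d ⟩
  countSep (relabellings m ρ) a b c d + countSep (relabellings m (exchange m ∘ₚ ρ)) a b c d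
    ≡⟨ cong₂ _+_ (counted ρ) (counted (exchange m ∘ₚ ρ)) ⟩
  w * f ρ + w * f (exchange m ∘ₚ ρ)
    ≡⟨ *-distribˡ-+ w (f ρ) (f (exchange m ∘ₚ ρ)) ⟨
  w * (f ρ + f (exchange m ∘ₚ ρ)) ∎
  where open ≡-Reasoning

module _ {n : ℕ} (ρ : LinOrd (1 + (2 + n) + (2 + n))) where

  private
    m : ℕ
    m = 2 + n

  countSep-orbit-yx-zx : ∀ {i k} j → i ≢ k →
    countSep (orbit m ρ) (yᵛ j) (xᵛ i) zero (xᵛ k) ≡ n ! * suc n ! * hubSeparations m ρ
  countSep-orbit-yx-zx j i≢k = trans
    (countSep-orbit m (n ! * suc n !) (spokeSeparationsˣ m) (λ π → countSep-relabellings-yx-zx π j i≢k) ρ)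
    (cong (λ s → n ! * suc n ! * (spokeSeparationsˣ m ρ + s)) (spokeSeparationsˣ-exchange m ρ))

  countSep-orbit-xy-zy : ∀ {i k} j → i ≢ k →
    countSep (orbit m ρ) (xᵛ j) (yᵛ i) zero (yᵛ k) ≡ n ! * suc n ! * hubSeparations m ρ
  countSep-orbit-xy-zy {i} {k} j i≢k = begin
    countSep (orbit m ρ) (xᵛ j) (yᵛ i) zero (yᵛ k)
      ≡⟨ countSep-orbit m (n ! * suc n !) (spokeSeparationsʸ m) (λ π → countSep-relabellings-xy-zy π j i≢k) ρ ⟩
    n ! * suc n ! * (spokeSeparationsʸ m ρ + spokeSeparationsʸ m (exchange m ∘ₚ ρ))
      ≡⟨ cong (λ s → n ! * suc n ! * (spokeSeparationsʸ m ρ + s)) (spokeSeparationsʸ-exchange m ρ) ⟩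
    n ! * suc n ! * (spokeSeparationsʸ m ρ + spokeSeparationsˣ m ρ)
      ≡⟨ cong (n ! * suc n ! *_) (+-comm (spokeSeparationsʸ m ρ) (spokeSeparationsˣ m ρ)) ⟩
    n ! * suc n ! * hubSeparations m ρ ∎
    where open ≡-Reasoning

  countSep-orbit-xy-xy : ∀ {i j k l} → i ≢ j → k ≢ l →
    countSep (orbit m ρ) (xᵛ i) (yᵛ k) (xᵛ j) (yᵛ l) ≡ n ! * n ! * (2 * rimSeparations m ρ)
  countSep-orbit-xy-xy {i} {j} {k} {l} i≢j k≢l = begin
    countSep (orbit m ρ) (xᵛ i) (yᵛ k) (xᵛ j) (yᵛ l)
      ≡⟨ countSep-orbit m (n ! * n !) (rimSeparations m) (λ π → countSep-relabellings-xy-xy π i≢j k≢l) ρ ⟩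
    n ! * n ! * (rimSeparations m ρ + rimSeparations m (exchange m ∘ₚ ρ))
      ≡⟨ cong (λ s → n ! * n ! * (rimSeparations m ρ + s)) (rimSeparations-exchange m ρ) ⟩
    n ! * n ! * (rimSeparations m ρ + rimSeparations m ρ)
      ≡⟨ cong (λ s → n ! * n ! * (rimSeparations m ρ + s)) (+-identityʳ (rimSeparations m ρ)) ⟨
    n ! * n ! * (2 * rimSeparations m ρ) ∎
    where open ≡-Reasoning

  orbit-tSeparating : suc n * hubSeparations m ρ ≤ 2 * rimSeparations m ρ →
                      TSeparating m (n ! * suc n ! * hubSeparations m ρ) (orbit m ρ)
  orbit-tSeparating hub≤rim = nonincident-elim (λ a b c d → t ≤ countSep (orbit m ρ) a b c d)
    (λ {a} {b} {c} {d} → resp λ π → sep-flipˡ (pos π a) (pos π b) (pos π c) (pos π d))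
    (λ {a} {b} {c} {d} → resp λ π → sep-swap (pos π a) (pos π b) (pos π c) (pos π d))
    (λ j i≢k → ≤-reflexive (sym (countSep-orbit-yx-zx j i≢k)))
    (λ j i≢k → ≤-reflexive (sym (countSep-orbit-xy-zy j i≢k)))
    (λ i≢j k≢l → ≤-trans t≤rim (≤-reflexive (sym (countSep-orbit-xy-xy i≢j k≢l))))
    where
    open ≤-Reasoning
    t : ℕ
    t = n ! * suc n ! * hubSeparations m ρ
    resp : ∀ {a b c d a′ b′ c′ d′} → (∀ π → separates π a b c d ≡ separates π a′ b′ c′ d′) →
           t ≤ countSep (orbit m ρ) a b c d → t ≤ countSep (orbit m ρ) a′ b′ c′ d′
    resp same = subst (t ≤_) (countSep-cong same (orbit m ρ))
    regroup : ∀ a s h → a * (s * a) * h ≡ a * a * (s * h)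
    regroup = solve-∀
    t≤rim : t ≤ n ! * n ! * (2 * rimSeparations m ρ)
    t≤rim = begin
      n ! * (suc n * n !) * hubSeparations m ρ     ≡⟨ regroup (n !) (suc n) (hubSeparations m ρ) ⟩
      n ! * n ! * (suc n * hubSeparations m ρ)     ≤⟨ *-monoʳ-≤ (n ! * n !) hub≤rim ⟩
      n ! * n ! * (2 * rimSeparations m ρ)         ∎

-- The balanced ordering x₀ y₀ x₁ y₁ …, with z inserted after the first ⌊m/2⌋ pairs

⊎↔×2 : ∀ {A : Set} → (A ⊎ A) ↔ (A × Fin 2)
⊎↔×2 = mk↔ₛ′ (λ { (inj₁ a) → a , 0F ; (inj₂ a) → a , 1F }) (λ { (a , 0F) → inj₁ a ; (a , 1F) → inj₂ a })
             (λ { (a , 0F) → refl ; (a , 1F) → refl }) (λ { (inj₁ a) → refl ; (inj₂ a) → refl })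

m*2≡m+m : ∀ m → m * 2 ≡ m + m
m*2≡m+m m = trans (*-comm m 2) (cong (m +_) (+-identityʳ m))

slots : ∀ m → (Fin m ⊎ Fin m) ↔ Fin (m + m)
slots m = ↔-trans ⊎↔×2 (↔-trans (↔-sym (*↔× {m} {2})) (cast-id (m*2≡m+m m)))

hubSlot : ∀ m → Fin (suc (m + m))
hubSlot m = fromℕ< {⌊ m /2⌋ * 2} (s≤s (≤-trans (*-monoˡ-≤ 2 (⌊n/2⌋≤n m)) (≤-reflexive (m*2≡m+m m))))

abstract
  balanced : ∀ m → LinOrd (1 + m + m)
  balanced m = insert zero (hubSlot m) (↔-trans (+↔⊎ {m} {m}) (slots m))

  pos-balanced-hub : ∀ m → pos (balanced m) zero ≡ toℕ (hubSlot m)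
  pos-balanced-hub m = refl

  pos-balanced-vertex : ∀ m s →
    pos (balanced m) (vertex s) ≡ toℕ (punchIn (hubSlot m) (Inverse.to (slots m) s))
  pos-balanced-vertex m s =
    cong (λ r → toℕ (punchIn (hubSlot m) (Inverse.to (slots m) r))) (splitAt-join m m s)

index : ∀ {m} → Fin m ⊎ Fin m → ℕ
index s = toℕ (proj₁ (Inverse.to ⊎↔×2 s))

offset : ∀ {m} → Fin m ⊎ Fin m → Fin 2
offset s = proj₂ (Inverse.to ⊎↔×2 s)

toℕ-slots : ∀ m s → toℕ (Inverse.to (slots m) s) ≡ index s * 2 + toℕ (offset s)
toℕ-slots m s = begin
  toℕ (Inverse.to (slots m) s)
    ≡⟨ toℕ-cast (m*2≡m+m m) (combine (proj₁ (Inverse.to ⊎↔×2 s)) (offset s)) ⟩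
  toℕ (combine (proj₁ (Inverse.to ⊎↔×2 s)) (offset s))
    ≡⟨ toℕ-combine (proj₁ (Inverse.to ⊎↔×2 s)) (offset s) ⟩
  2 * index s + toℕ (offset s)
    ≡⟨ cong (_+ toℕ (offset s)) (*-comm 2 (index s)) ⟩
  index s * 2 + toℕ (offset s) ∎
  where open ≡-Reasoning

*2-<ᵇ : ∀ i j (a b : Fin 2) →
        (i * 2 + toℕ a <ᵇ j * 2 + toℕ b) ≡ (if toℕ a <ᵇ toℕ b then i <ᵇ suc j else i <ᵇ j)
*2-<ᵇ zero    zero    0F 0F = refl
*2-<ᵇ zero    zero    0F 1F = refl
*2-<ᵇ zero    zero    1F 0F = refl
*2-<ᵇ zero    zero    1F 1F = refl
*2-<ᵇ zero    (suc j) 0F 0F = refl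
*2-<ᵇ zero    (suc j) 0F 1F = refl
*2-<ᵇ zero    (suc j) 1F 0F = refl
*2-<ᵇ zero    (suc j) 1F 1F = refl
*2-<ᵇ (suc i) zero    0F 0F = refl
*2-<ᵇ (suc i) zero    0F 1F = refl
*2-<ᵇ (suc i) zero    1F 0F = refl
*2-<ᵇ (suc i) zero    1F 1F = refl
*2-<ᵇ (suc i) (suc j) a  b  = *2-<ᵇ i j a b

punchIn-<ᵇ : ∀ {n} (k : Fin (suc n)) i j → (toℕ (punchIn k i) <ᵇ toℕ (punchIn k j)) ≡ (toℕ i <ᵇ toℕ j)
punchIn-<ᵇ zero    i       j       = refl
punchIn-<ᵇ (suc k) zero    zero    = refl
punchIn-<ᵇ (suc k) zero    (suc j) = refl
punchIn-<ᵇ (suc k) (suc i) zero    = refl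
punchIn-<ᵇ (suc k) (suc i) (suc j) = punchIn-<ᵇ k i j

punchIn-<ᵇ-pivot : ∀ {n} (k : Fin (suc n)) i → (toℕ (punchIn k i) <ᵇ toℕ k) ≡ (toℕ i <ᵇ toℕ k)
punchIn-<ᵇ-pivot zero    i       = refl
punchIn-<ᵇ-pivot (suc k) zero    = refl
punchIn-<ᵇ-pivot (suc k) (suc i) = punchIn-<ᵇ-pivot k i

toℕ+opposite : ∀ {n} (i : Fin n) → suc (toℕ i + toℕ (opposite i)) ≡ n
toℕ+opposite {n} i = trans (cong (suc (toℕ i) +_) (opposite-prop i)) (m+[n∸m]≡n (toℕ<n i))

module Balanced (m : ℕ) where

  private
    ρ : LinOrd (1 + m + m)
    ρ = balanced m

    x y : Fin m → ℕ
    x = posˣ m ρ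
    y = posʸ m ρ

    z h h′ : ℕ
    z  = posᶻ m ρ
    h  = ⌊ m /2⌋
    h′ = ⌈ m /2⌉

    open Distinct (pos-distinct m ρ)

    slot : Fin m ⊎ Fin m → Fin (m + m)
    slot = Inverse.to (slots m)

  pos-<ᵇ : ∀ s t → (pos ρ (vertex s) <ᵇ pos ρ (vertex t))
         ≡ (if toℕ (offset s) <ᵇ toℕ (offset t) then index s <ᵇ suc (index t) else index s <ᵇ index t)
  pos-<ᵇ s t = begin
    (pos ρ (vertex s) <ᵇ pos ρ (vertex t))
      ≡⟨ cong₂ _<ᵇ_ (pos-balanced-vertex m s) (pos-balanced-vertex m t) ⟩
    (toℕ (punchIn (hubSlot m) (slot s)) <ᵇ toℕ (punchIn (hubSlot m) (slot t)))
      ≡⟨ punchIn-<ᵇ (hubSlot m) (slot s) (slot t) ⟩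
    (toℕ (slot s) <ᵇ toℕ (slot t))
      ≡⟨ cong₂ _<ᵇ_ (toℕ-slots m s) (toℕ-slots m t) ⟩
    (index s * 2 + toℕ (offset s) <ᵇ index t * 2 + toℕ (offset t))
      ≡⟨ *2-<ᵇ (index s) (index t) (offset s) (offset t) ⟩
    (if toℕ (offset s) <ᵇ toℕ (offset t) then index s <ᵇ suc (index t) else index s <ᵇ index t) ∎
    where open ≡-Reasoning

  pos-<ᵇ-hub : ∀ s → (pos ρ (vertex s) <ᵇ z) ≡ (index s <ᵇ h)
  pos-<ᵇ-hub s = begin
    (pos ρ (vertex s) <ᵇ z)
      ≡⟨ cong₂ _<ᵇ_ (pos-balanced-vertex m s) (pos-balanced-hub m) ⟩
    (toℕ (punchIn (hubSlot m) (slot s)) <ᵇ toℕ (hubSlot m))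
      ≡⟨ punchIn-<ᵇ-pivot (hubSlot m) (slot s) ⟩
    (toℕ (slot s) <ᵇ toℕ (hubSlot m))
      ≡⟨ cong₂ _<ᵇ_ (toℕ-slots m s) (trans (toℕ-fromℕ< _) (sym (+-identityʳ (h * 2)))) ⟩
    (index s * 2 + toℕ (offset s) <ᵇ h * 2 + 0)
      ≡⟨ *2-<ᵇ (index s) h (offset s) 0F ⟩
    (index s <ᵇ h) ∎
    where open ≡-Reasoning

  below-x-y : ∀ j → below x (y j) ≡ suc (toℕ j)
  below-x-y j = ∑-[]-initial (toℕ<n j) λ i → pos-<ᵇ (inj₁ i) (inj₂ j)

  below-y-x : ∀ i → below y (x i) ≡ toℕ i
  below-y-x i = ∑-[]-initial (<⇒≤ (toℕ<n i)) λ j → pos-<ᵇ (inj₂ j) (inj₁ i)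

  below-x-z : below x z ≡ h
  below-x-z = ∑-[]-initial (⌊n/2⌋≤n m) λ i → pos-<ᵇ-hub (inj₁ i)

  below-y-z : below y z ≡ h
  below-y-z = ∑-[]-initial (⌊n/2⌋≤n m) λ j → pos-<ᵇ-hub (inj₂ j)

  above-x-y : ∀ j → above x (y j) ≡ toℕ (opposite j)
  above-x-y j = above-complement (λ i → x≢y i j) (below-x-y j) (toℕ+opposite j)

  above-y-x : ∀ i → above y (x i) ≡ suc (toℕ (opposite i))
  above-y-x i = above-complement (λ j → x≢y i j ∘ sym) (below-y-x i)
                                 (trans (+-suc (toℕ i) (toℕ (opposite i))) (toℕ+opposite i))

  above-x-z : above x z ≡ h′
  above-x-z = above-complement x≢z below-x-z (⌊n/2⌋+⌈n/2⌉≡n m)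

  above-y-z : above y z ≡ h′
  above-y-z = above-complement y≢z below-y-z (⌊n/2⌋+⌈n/2⌉≡n m)

  costBelow-balanced : costBelow x y z ≡ sideCost h h h′ h′
  costBelow-balanced = begin
    costBelow x y z
      ≡⟨ cong₂ _+_ (sum-cong-≗ (cong pairs ∘ below-x)) (sum-cong-≗ (cong pairs ∘ below-y)) ⟩
    partialSum (λ j → pairs (suc j ⊓ h)) m + partialSum (λ i → pairs (i ⊓ h)) m
      ≡⟨ partialSum-pairs-⊓ h h′ (⌊n/2⌋+⌈n/2⌉≡n m) ⟩
    sideCost h h h′ h′ ∎
    where
    open ≡-Reasoning
    below-x : ∀ j → below x (y j ⊓ z) ≡ suc (toℕ j) ⊓ h
    below-x j = trans (below-⊓ x (y j) z) (cong₂ _⊓_ (below-x-y j) below-x-z)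
    below-y : ∀ i → below y (x i ⊓ z) ≡ toℕ i ⊓ h
    below-y i = trans (below-⊓ y (x i) z) (cong₂ _⊓_ (below-y-x i) below-y-z)

  costAbove-balanced : costAbove x y z ≡ sideCost h′ h′ h h
  costAbove-balanced = begin
    costAbove x y z
      ≡⟨ cong₂ _+_ (sum-cong-≗ (cong pairs ∘ above-x)) (sum-cong-≗ (cong pairs ∘ above-y)) ⟩
    ∑[ j < m ] pairs (toℕ (opposite j) ⊓ h′) + ∑[ i < m ] pairs (suc (toℕ (opposite i)) ⊓ h′)
      ≡⟨ cong₂ _+_ (sum-permute {m} (λ j → pairs (toℕ j ⊓ h′)) reverse)
                   (sum-permute {m} (λ i → pairs (suc (toℕ i) ⊓ h′)) reverse) ⟨
    partialSum (λ j → pairs (j ⊓ h′)) m + partialSum (λ i → pairs (suc i ⊓ h′)) m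
      ≡⟨ +-comm (partialSum (λ j → pairs (j ⊓ h′)) m) (partialSum (λ i → pairs (suc i ⊓ h′)) m) ⟩
    partialSum (λ i → pairs (suc i ⊓ h′)) m + partialSum (λ j → pairs (j ⊓ h′)) m
      ≡⟨ partialSum-pairs-⊓ h′ h (trans (+-comm h′ h) (⌊n/2⌋+⌈n/2⌉≡n m)) ⟩
    sideCost h′ h′ h h ∎
    where
    open ≡-Reasoning
    above-x : ∀ j → above x (y j ⊔ z) ≡ toℕ (opposite j) ⊓ h′
    above-x j = trans (above-⊔ x (y j) z) (cong₂ _⊓_ (above-x-y j) above-x-z)
    above-y : ∀ i → above y (x i ⊔ z) ≡ suc (toℕ (opposite i)) ⊓ h′
    above-y i = trans (above-⊔ y (x i) z) (cong₂ _⊓_ (above-y-x i) above-y-z)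

  hubSeparations-balanced : hubSeparations m ρ + squareSum m ≡ m * pairs m + balance m
  hubSeparations-balanced = *-cancelˡ-≡ _ _ 2 (begin
    2 * (hubSeparations m ρ + squareSum m)
      ≡⟨ *-distribˡ-+ 2 (hubSeparations m ρ) (squareSum m) ⟩
    2 * hubSeparations m ρ + 2 * squareSum m
      ≡⟨ cong (λ n → 2 * hubSeparations m ρ + 2 * squareSum n) (⌊n/2⌋+⌈n/2⌉≡n m) ⟨
    2 * hubSeparations m ρ + 2 * squareSum (h + h′)
      ≡⟨ cong (2 * hubSeparations m ρ +_) (cutCost-square h h′) ⟨
    2 * hubSeparations m ρ + (cutCost h h h′ h′ + 2 * balance m)
      ≡⟨ +-assoc (2 * hubSeparations m ρ) (cutCost h h h′ h′) (2 * balance m) ⟨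
    2 * hubSeparations m ρ + cutCost h h h′ h′ + 2 * balance m
      ≡⟨ cong₂ (λ s t → 2 * hubSeparations m ρ + (s + t) + 2 * balance m)
               costBelow-balanced costAbove-balanced ⟨
    2 * hubSeparations m ρ + (costBelow x y z + costAbove x y z) + 2 * balance m
      ≡⟨ cong (_+ 2 * balance m) (hubCrossings-identity (pos-distinct m ρ)) ⟩
    m * pairs m + m * pairs m + 2 * balance m
      ≡⟨ collect (m * pairs m) (balance m) ⟩
    2 * (m * pairs m + balance m) ∎)
    where
    open ≡-Reasoning
    collect : ∀ p b → p + p + 2 * b ≡ 2 * (p + b)
    collect = solve-∀

  ∑≠-pairs-below-balanced : ∑≠ (λ i j → pairs (below y (x i ⊓ x j))) ≡ 2 * partialSum (partialSum pairs) m
  ∑≠-pairs-below-balanced = trans (∑≠-cong {m} λ {i} {j} _ → cong pairs (below-y i j)) (∑≠-⊓ pairs m)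
    where
    below-y : ∀ i j → below y (x i ⊓ x j) ≡ toℕ i ⊓ toℕ j
    below-y i j = trans (below-⊓ y (x i) (x j)) (cong₂ _⊓_ (below-y-x i) (below-y-x j))

  ∑≠-pairs-above-balanced :
    ∑≠ (λ i j → pairs (above y (x i ⊔ x j))) ≡ 2 * partialSum (partialSum (pairs ∘ suc)) m
  ∑≠-pairs-above-balanced = begin
    ∑≠ (λ i j → pairs (above y (x i ⊔ x j)))
      ≡⟨ ∑≠-cong {m} (λ {i} {j} _ → cong pairs (above-y i j)) ⟩
    ∑≠ {m} (λ i j → pairs (suc (toℕ (opposite i) ⊓ toℕ (opposite j))))
      ≡⟨ ∑≠-permute {m} (λ i j → pairs (suc (toℕ i ⊓ toℕ j))) reverse ⟨
    ∑≠ {m} (λ i j → pairs (suc (toℕ i ⊓ toℕ j)))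
      ≡⟨ ∑≠-⊓ (pairs ∘ suc) m ⟩
    2 * partialSum (partialSum (pairs ∘ suc)) m ∎
    where
    open ≡-Reasoning
    above-y : ∀ i j → above y (x i ⊔ x j) ≡ suc (toℕ (opposite i) ⊓ toℕ (opposite j))
    above-y i j = trans (above-⊔ y (x i) (x j)) (cong₂ _⊓_ (above-y-x i) (above-y-x j))

  rimSeparations-balanced : 2 * rimSeparations m ρ + 4 * partialSum squareSum m ≡ pairs m * pairs m
  rimSeparations-balanced = begin
    2 * rimSeparations m ρ + 4 * partialSum squareSum m
      ≡⟨ cong (2 * rimSeparations m ρ +_) (∑-partialSum-pairs m) ⟨
    2 * rimSeparations m ρ + (2 * partialSum (partialSum pairs) m + 2 * partialSum (partialSum (pairs ∘ suc)) m)
      ≡⟨ cong (2 * rimSeparations m ρ +_) (cong₂ _+_ ∑≠-pairs-below-balanced ∑≠-pairs-above-balanced) ⟨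
    2 * rimSeparations m ρ
      + (∑≠ (λ i j → pairs (below y (x i ⊓ x j))) + ∑≠ (λ i j → pairs (above y (x i ⊔ x j))))
      ≡⟨ ∑∑-crossings-identity x-injective y-injective x≢y ⟩
    pairs m * pairs m ∎
    where open ≡-Reasoning

-- Closed forms

squareSum-closed : ∀ n → 6 * squareSum (suc n) ≡ pairs (suc n) * (2 * n + 1)
squareSum-closed zero    = refl
squareSum-closed (suc n) = begin
  6 * squareSum (2 + n)
    ≡⟨ cong (6 *_) (partialSum-suc (λ i → i * i) (suc n)) ⟩
  6 * (squareSum (suc n) + suc n * suc n)
    ≡⟨ *-distribˡ-+ 6 (squareSum (suc n)) (suc n * suc n) ⟩
  6 * squareSum (suc n) + 6 * (suc n * suc n)
    ≡⟨ cong (_+ 6 * (suc n * suc n)) (squareSum-closed n) ⟩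
  suc n * n * (2 * n + 1) + 6 * (suc n * suc n)
    ≡⟨ factor n ⟩
  (2 + n) * suc n * (2 * suc n + 1) ∎
  where
  open ≡-Reasoning
  factor : ∀ n → suc n * n * (2 * n + 1) + 6 * (suc n * suc n) ≡ (2 + n) * suc n * (2 * suc n + 1)
  factor = solve-∀

partialSum-squareSum-closed : ∀ n → 12 * partialSum squareSum (suc n) ≡ pairs (suc n) * pairs n
partialSum-squareSum-closed zero    = refl
partialSum-squareSum-closed (suc n) = begin
  12 * partialSum squareSum (2 + n)
    ≡⟨ cong (12 *_) (partialSum-suc squareSum (suc n)) ⟩
  12 * (partialSum squareSum (suc n) + squareSum (suc n))
    ≡⟨ regroup (partialSum squareSum (suc n)) (squareSum (suc n)) ⟩
  12 * partialSum squareSum (suc n) + 2 * (6 * squareSum (suc n))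
    ≡⟨ cong₂ (λ s t → s + 2 * t) (partialSum-squareSum-closed n) (squareSum-closed n) ⟩
  suc n * n * pairs n + 2 * (suc n * n * (2 * n + 1))
    ≡⟨ factor n (pairs n) ⟩
  suc n * n * (n + pairs n) + suc n * n * (3 * n + 2)
    ≡⟨ cong (λ s → suc n * n * s + suc n * n * (3 * n + 2)) (pairs-square n) ⟨
  suc n * n * (n * n) + suc n * n * (3 * n + 2)
    ≡⟨ expand n ⟩
  (2 + n) * suc n * (suc n * n) ∎
  where
  open ≡-Reasoning
  regroup : ∀ a b → 12 * (a + b) ≡ 12 * a + 2 * (6 * b)
  regroup = solve-∀
  factor : ∀ n p → suc n * n * p + 2 * (suc n * n * (2 * n + 1))
                 ≡ suc n * n * (n + p) + suc n * n * (3 * n + 2)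
  factor = solve-∀
  expand : ∀ n → suc n * n * (n * n) + suc n * n * (3 * n + 2) ≡ (2 + n) * suc n * (suc n * n)
  expand = solve-∀

hubSeparations-closed : ∀ n → 6 * hubSeparations (suc n) (balanced (suc n))
                            ≡ pairs (suc n) * (4 * n + 5) + 6 * balance (suc n)
hubSeparations-closed n = +-cancelʳ-≡ (pairs (suc n) * (2 * n + 1)) _ _ (begin
  6 * hub + pairs (suc n) * (2 * n + 1)
    ≡⟨ cong (6 * hub +_) (squareSum-closed n) ⟨
  6 * hub + 6 * squareSum (suc n)
    ≡⟨ *-distribˡ-+ 6 hub (squareSum (suc n)) ⟨
  6 * (hub + squareSum (suc n))
    ≡⟨ cong (6 *_) (Balanced.hubSeparations-balanced (suc n)) ⟩
  6 * (suc n * pairs (suc n) + balance (suc n))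
    ≡⟨ regroup n (pairs (suc n)) (balance (suc n)) ⟩
  pairs (suc n) * (4 * n + 5) + 6 * balance (suc n) + pairs (suc n) * (2 * n + 1) ∎)
  where
  open ≡-Reasoning
  hub : ℕ
  hub = hubSeparations (suc n) (balanced (suc n))
  regroup : ∀ n p b → 6 * (suc n * p + b) ≡ p * (4 * n + 5) + 6 * b + p * (2 * n + 1)
  regroup = solve-∀

rimSeparations-closed : ∀ n → 3 * rimSeparations (suc n) (balanced (suc n)) ≡ pairs (suc n) * (n * (n + 2))
rimSeparations-closed n = *-cancelˡ-≡ _ _ 2 (+-cancelʳ-≡ (pairs (suc n) * pairs n) _ _ (begin
  2 * (3 * rim) + pairs (suc n) * pairs n
    ≡⟨ cong (2 * (3 * rim) +_) (partialSum-squareSum-closed n) ⟨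
  2 * (3 * rim) + 12 * partialSum squareSum (suc n)
    ≡⟨ regroup rim (partialSum squareSum (suc n)) ⟩
  3 * (2 * rim + 4 * partialSum squareSum (suc n))
    ≡⟨ cong (3 *_) (Balanced.rimSeparations-balanced (suc n)) ⟩
  3 * (pairs (suc n) * (suc n * n))
    ≡⟨ expand n (pairs (suc n)) ⟩
  pairs (suc n) * (2 * (n * n) + 3 * n) + pairs (suc n) * (n * n)
    ≡⟨ cong (λ s → pairs (suc n) * (2 * (n * n) + 3 * n) + pairs (suc n) * s) (pairs-square n) ⟩
  pairs (suc n) * (2 * (n * n) + 3 * n) + pairs (suc n) * (n + pairs n)
    ≡⟨ collect n (pairs (suc n)) (pairs n) ⟩
  2 * (pairs (suc n) * (n * (n + 2))) + pairs (suc n) * pairs n ∎))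
  where
  open ≡-Reasoning
  rim : ℕ
  rim = rimSeparations (suc n) (balanced (suc n))
  regroup : ∀ r s → 2 * (3 * r) + 12 * s ≡ 3 * (2 * r + 4 * s)
  regroup = solve-∀
  expand : ∀ n p → 3 * (p * (suc n * n)) ≡ p * (2 * (n * n) + 3 * n) + p * (n * n)
  expand = solve-∀
  collect : ∀ n p q → p * (2 * (n * n) + 3 * n) + p * (n + q) ≡ 2 * (p * (n * (n + 2))) + p * q
  collect = solve-∀

halves-product : ∀ n → 2 * (⌊ 2 + n /2⌋ * (2 * ⌈ 2 + n /2⌉ ∸ 1)) ≡ pairs (2 + n)
halves-product zero          = refl
halves-product (suc zero)    = refl
halves-product (suc (suc n)) = begin
  2 * (suc f * (c + (suc c + 0)))
    ≡⟨ expand ⌊ n /2⌋ ⌈ n /2⌉ ⟩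
  2 * (f * (⌈ n /2⌉ + (c + 0))) + 4 * (f + c) + 2
    ≡⟨ cong₂ (λ s t → s + 4 * t + 2) (halves-product n) (⌊n/2⌋+⌈n/2⌉≡n (2 + n)) ⟩
  (2 + n) * suc n + 4 * (2 + n) + 2
    ≡⟨ solve (n ∷ []) ⟩
  (4 + n) * (3 + n) ∎
  where
  open ≡-Reasoning
  f c : ℕ
  f = ⌊ 2 + n /2⌋
  c = ⌈ 2 + n /2⌉
  expand : ∀ f c → 2 * (suc (suc f) * (suc c + (suc (suc c) + 0)))
                 ≡ 2 * (suc f * (c + (suc c + 0))) + 4 * (suc f + suc c) + 2
  expand = solve-∀

2*balance≤pairs : ∀ n → 2 * balance (2 + n) ≤ pairs (2 + n)
2*balance≤pairs n = ≤-trans (*-monoʳ-≤ 2 (*-monoʳ-≤ ⌊ 2 + n /2⌋ c≤2c∸1)) (≤-reflexive (halves-product n))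
  where
  c≤2c∸1 : ⌈ 2 + n /2⌉ ≤ 2 * ⌈ 2 + n /2⌉ ∸ 1
  c≤2c∸1 = ≤-trans (m≤m+n (suc ⌈ n /2⌉) (⌈ n /2⌉ + 0)) (≤-reflexive (sym (+-suc ⌈ n /2⌉ (⌈ n /2⌉ + 0))))

hubSeparations-≤-rimSeparations : ∀ n →
  suc n * hubSeparations (2 + n) (balanced (2 + n)) ≤ 2 * rimSeparations (2 + n) (balanced (2 + n))
hubSeparations-≤-rimSeparations n = *-cancelˡ-≤ 6 (begin
  6 * (suc n * hub)
    ≡⟨ *.x∙yz≈y∙xz 6 (suc n) hub ⟩
  suc n * (6 * hub)
    ≡⟨ cong (suc n *_) (hubSeparations-closed (suc n)) ⟩
  suc n * (pairs (2 + n) * (4 * suc n + 5) + 6 * balance (2 + n))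
    ≡⟨ regroup (suc n) (pairs (2 + n)) (balance (2 + n)) ⟩
  suc n * (pairs (2 + n) * (4 * suc n + 5)) + 3 * suc n * (2 * balance (2 + n))
    ≤⟨ +-monoʳ-≤ (suc n * (pairs (2 + n) * (4 * suc n + 5))) (*-monoʳ-≤ (3 * suc n) (2*balance≤pairs n)) ⟩
  suc n * (pairs (2 + n) * (4 * suc n + 5)) + 3 * suc n * pairs (2 + n)
    ≡⟨ collect (suc n) (pairs (2 + n)) ⟩
  4 * (pairs (2 + n) * (suc n * (suc n + 2)))
    ≡⟨ cong (4 *_) (rimSeparations-closed (suc n)) ⟨
  4 * (3 * rim)
    ≡⟨ trans (sym (*-assoc 4 3 rim)) (*-assoc 6 2 rim) ⟩
  6 * (2 * rim) ∎)
  where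
  open ≤-Reasoning
  hub rim : ℕ
  hub = hubSeparations (2 + n) (balanced (2 + n))
  rim = rimSeparations (2 + n) (balanced (2 + n))
  regroup : ∀ k p b → k * (p * (4 * k + 5) + 6 * b) ≡ k * (p * (4 * k + 5)) + 3 * k * (2 * b)
  regroup = solve-∀
  collect : ∀ k p → k * (p * (4 * k + 5)) + 3 * k * p ≡ 4 * (p * (k * (k + 2)))
  collect = solve-∀

target-cross-multiplied : ∀ n → let m = 2 + n ; d = 2 * ⌈ m /2⌉ ∸ 1 in
  2 * (m * pairs m) * suc ((8 * m + 5) * d + 2) ≡ 24 * m * d * hubSeparations m (balanced m)
target-cross-multiplied n = *-cancelˡ-≡ _ _ 6 (begin
  6 * (2 * (m * p) * suc ((8 * m + 5) * d + 2))
    ≡⟨ expand (suc n) d p ⟩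
  24 * m * d * (p * (4 * suc n + 5)) + 36 * m * (2 * c * p)
    ≡⟨ cong (λ q → 24 * m * d * (p * (4 * suc n + 5)) + 36 * m * (2 * c * q)) (halves-product n) ⟨
  24 * m * d * (p * (4 * suc n + 5)) + 36 * m * (2 * c * (2 * (f * d)))
    ≡⟨ collect m d c f (p * (4 * suc n + 5)) ⟩
  24 * m * d * (p * (4 * suc n + 5) + 6 * (f * c))
    ≡⟨ cong (24 * m * d *_) (hubSeparations-closed (suc n)) ⟨
  24 * m * d * (6 * hub)
    ≡⟨ *.x∙yz≈y∙xz (24 * m * d) 6 hub ⟩
  6 * (24 * m * d * hub) ∎)
  where
  open ≡-Reasoning
  m f c d p hub : ℕ
  m = 2 + n
  f = ⌊ m /2⌋
  c = ⌈ m /2⌉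
  d = 2 * c ∸ 1
  p = pairs m
  hub = hubSeparations m (balanced m)
  -- The right-hand side contains suc d, which is 2 * c by computation.
  expand : ∀ k d p → 6 * (2 * (suc k * p) * suc ((8 * suc k + 5) * d + 2))
                   ≡ 24 * suc k * d * (p * (4 * k + 5)) + 36 * suc k * (suc d * p)
  expand = solve-∀
  collect : ∀ m d c f q → 24 * m * d * q + 36 * m * (2 * c * (2 * (f * d))) ≡ 24 * m * d * (q + 6 * (f * c))
  collect = solve-∀

-- Existence of π_t

Least : (ℕ → Set) → Set
Least Q = ∃[ k ] (Q k × (∀ j → Q j → k ≤ j))

least : {Q : ℕ → Set} → (∀ k → Dec (Q k)) → ∀ n → Q n → Least Q
least {Q} Q? = <-rec (λ n → Q n → Least Q) descend
  where
  descend : ∀ n → (∀ {k} → k < n → Q k → Least Q) → Q n → Least Q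
  descend n smaller Qn with anyUpTo? Q? n
  ... | yes (k , k<n , Qk) = smaller k<n Qk
  ... | no  none           = n , Qn , λ j Qj → ≮⇒≥ λ j<n → none (j , j<n , Qj)

listsOfOrders : ∀ n → ℕ → List (List (LinOrd n))
listsOfOrders n zero    = [] ∷ []
listsOfOrders n (suc k) = cartesianProductWith _∷_ (permutations n) (listsOfOrders n k)

listsOfOrders-complete : ∀ {n} (L : List (LinOrd n)) →
                       Any (λ M → Pointwise _≈_ M L) (listsOfOrders n (length L))
listsOfOrders-complete []      = here Pointwise.[]
listsOfOrders-complete (ρ ∷ L) =
  cartesianProductWith⁺ _∷_ Pointwise._∷_ (permutations-complete ρ) (listsOfOrders-complete L)

countSep-resp-≈ : ∀ {n} {L M : List (LinOrd n)} → Pointwise _≈_ L M → ∀ a b c d →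
                  countSep L a b c d ≡ countSep M a b c d
countSep-resp-≈ Pointwise.[]          a b c d = refl
countSep-resp-≈ (σ≈τ Pointwise.∷ L≈M) a b c d = cong₂ _+_
  (cong [_] (sep-cong (cong toℕ (σ≈τ a)) (cong toℕ (σ≈τ b)) (cong toℕ (σ≈τ c)) (cong toℕ (σ≈τ d))))
  (countSep-resp-≈ L≈M a b c d)

tSeparating-resp-≈ : ∀ {m t L M} → Pointwise _≈_ M L → TSeparating m t L → TSeparating m t M
tSeparating-resp-≈ {t = t} M≈L separating a b c d nonincident =
  subst (t ≤_) (sym (countSep-resp-≈ M≈L a b c d)) (separating a b c d nonincident)

tSeparating? : ∀ m t L → Dec (TSeparating m t L)
tSeparating? m t L = all? λ a → all? λ b → all? λ c → all? λ d →
  (¬? (part m a ≟ part m b) ×-dec ¬? (part m c ≟ part m d) ×-dec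
   ¬? (a ≟ᶠ c) ×-dec ¬? (a ≟ᶠ d) ×-dec ¬? (b ≟ᶠ c) ×-dec ¬? (b ≟ᶠ d))
  →-dec (t ≤? countSep L a b c d)

tSeparatingOfLength? : ∀ m t k → Dec (∃[ L ] (length L ≡ k × TSeparating m t L))
tSeparatingOfLength? m t k = map′ satisfied
  (λ { (L , refl , separating) →
       Any.map (λ M≈L → Pointwise-length M≈L , tSeparating-resp-≈ M≈L separating) (listsOfOrders-complete L) })
  (Any.any? (λ M → (length M ≟ k) ×-dec tSeparating? m t M) (listsOfOrders (1 + m + m) k))

πₜ-exists : ∀ {m t} L → TSeparating m t L → ∃[ k ] IsPiT m t k
πₜ-exists {m} {t} L separating with least (tSeparatingOfLength? m t) (length L) (L , refl , separating)
... | k , attained , minimal =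
  k , attained , λ M M-separating → minimal (length M) (M , refl , M-separating)

-- Fractional separation dimension

copies : ∀ {A : Set} → ℕ → List A → List A
copies j L = concat (replicate j L)

length-copies : ∀ {A : Set} j (L : List A) → length (copies j L) ≡ j * length L
length-copies zero    L = refl
length-copies (suc j) L = trans (length-++ L) (cong (length L +_) (length-copies j L))

countSep-copies : ∀ {n} j (L : List (LinOrd n)) a b c d →
                  countSep (copies j L) a b c d ≡ j * countSep L a b c d
countSep-copies zero    L a b c d = refl
countSep-copies (suc j) L a b c d = trans (countSep-++ L (copies j L) a b c d)
                                          (cong (countSep L a b c d +_) (countSep-copies j L a b c d))

copies-tSeparating : ∀ {m s t} j L → s ≤ j * t → TSeparating m t L → TSeparating m s (copies j L)
copies-tSeparating {s = s} {t} j L s≤j*t separating a b c d nonincident = begin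
  s                             ≤⟨ s≤j*t ⟩
  j * t                         ≤⟨ *-monoʳ-≤ j (separating a b c d nonincident) ⟩
  j * countSep L a b c d        ≡⟨ countSep-copies j L a b c d ⟨
  countSep (copies j L) a b c d ∎
  where open ≤-Reasoning

/-mono-≤ : ∀ a b c d .{{_ : NonZero b}} .{{_ : NonZero d}} → a * d ≤ c * b → (ℤ.+ a) / b ≤ℚ (ℤ.+ c) / d
/-mono-≤ a (suc b) c (suc d) a*d≤c*b = ℚ.toℚᵘ-cancel-≤
  (ℚᵘ.≤-respˡ-≃ (ℚᵘ.≃-sym (ℚ.toℚᵘ-fromℚᵘ (mkℚᵘ (ℤ.+ a) b)))
  (ℚᵘ.≤-respʳ-≃ (ℚᵘ.≃-sym (ℚ.toℚᵘ-fromℚᵘ (mkℚᵘ (ℤ.+ c) d)))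
  (*≤* (subst₂ ℤ._≤_ (ℤ.pos-* a (suc d)) (ℤ.pos-* c (suc b)) (ℤ.+≤+ a*d≤c*b)))))

/-cong-cross : ∀ a b c d .{{_ : NonZero b}} .{{_ : NonZero d}} → a * d ≡ c * b → (ℤ.+ a) / b ≡ (ℤ.+ c) / d
/-cong-cross a b c d a*d≡c*b =
  ℚ.≤-antisym (/-mono-≤ a b c d (≤-reflexive a*d≡c*b)) (/-mono-≤ c d a b (≤-reflexive (sym a*d≡c*b)))

p-ε≤p : ∀ p ε → Positive ε → p - ε ≤ℚ p
p-ε≤p p ε ε>0 = subst (p - ε ≤ℚ_) (ℚ.+-identityʳ p)
  (ℚ.+-monoʳ-≤ p (ℚ.neg-antimono-≤ (ℚ.<⇒≤ (ℚ.positive⁻¹ ε {{ε>0}}))))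

p≤p+ε : ∀ p ε → Positive ε → p ≤ℚ p +ℚ ε
p≤p+ε p ε ε>0 = subst (_≤ℚ p +ℚ ε) (ℚ.+-identityʳ p) (ℚ.+-monoʳ-≤ p (ℚ.<⇒≤ (ℚ.positive⁻¹ ε {{ε>0}})))

-- A family attaining the bound for one t attains it, by repetition, for all multiples of t.
fracSepDim-attained : ∀ {m p q t} .{{_ : NonZero q}} .{{_ : NonZero t}} →
  (∀ {s} L → TSeparating m s L → p * s ≤ length L * q) →
  ∀ F → TSeparating m t F → length F * q ≡ p * t → FracSepDimIs m ((ℤ.+ p) / q)
fracSepDim-attained {m} {p} {q} {suc t} bound F separating attained =
  exists
  , (λ ε ε>0 → 0 , λ s _ k isPi → ℚ.≤-trans (p-ε≤p (ℤ.+ p / q) ε ε>0) (lower s k isPi))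
  , λ ε ε>0 N → let k , isPi = exists (multiple N) in
      multiple N , N≤multiple N , k , isPi , ℚ.≤-trans (upper N k isPi) (p≤p+ε (ℤ.+ p / q) ε ε>0)
  where
  exists : ∀ s → ∃[ k ] IsPiT m (suc s) k
  exists s = πₜ-exists (copies (suc s) F) (copies-tSeparating (suc s) F (m≤m*n (suc s) (suc t)) separating)

  lower : ∀ s k → IsPiT m (suc s) k → ℤ.+ p / q ≤ℚ ℤ.+ k / suc s
  lower s k ((L , refl , L-separating) , _) = /-mono-≤ p q (length L) (suc s) (bound L L-separating)

  multiple : ℕ → ℕ
  multiple N = t + N * suc t

  N≤multiple : ∀ N → N ≤ multiple N
  N≤multiple N = ≤-trans (m≤m*n N (suc t)) (m≤n+m (N * suc t) t)

  upper : ∀ N k → IsPiT m (suc (multiple N)) k → ℤ.+ k / suc (multiple N) ≤ℚ ℤ.+ p / q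
  upper N k (_ , minimal) = /-mono-≤ k (suc (multiple N)) p q (begin
    k * q
      ≤⟨ *-monoˡ-≤ q (minimal (copies (suc N) F) (copies-tSeparating (suc N) F ≤-refl separating)) ⟩
    length (copies (suc N) F) * q
      ≡⟨ cong (_* q) (length-copies (suc N) F) ⟩
    suc N * length F * q
      ≡⟨ *-assoc (suc N) (length F) q ⟩
    suc N * (length F * q)
      ≡⟨ cong (suc N *_) attained ⟩
    suc N * (p * suc t)
      ≡⟨ *.x∙yz≈y∙xz (suc N) p (suc t) ⟩
    p * suc (multiple N) ∎)
    where open ≤-Reasoning

total-≤ : ∀ {A : Set} {f : A → ℕ} {c} → (∀ a → f a ≤ c) → ∀ L → total f L ≤ length L * c
total-≤ {c = c} f≤c L = ≤-trans (∑-mono (f≤c ∘ lookup L)) (≤-reflexive (∑-const (length L) c))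

fracSepDim-K₁ₘₘ : ∀ n ρ → let m = 2 + n in .{{_ : NonZero (hubSeparations m ρ)}} →
  (∀ σ → hubSeparations m σ ≤ hubSeparations m ρ) → suc n * hubSeparations m ρ ≤ 2 * rimSeparations m ρ →
  FracSepDimIs m ((ℤ.+ (2 * (m * pairs m))) / hubSeparations m ρ)
fracSepDim-K₁ₘₘ n ρ hub-maximal hub≤rim = fracSepDim-attained {m} {t = n ! * suc n ! * hubSeparations m ρ}
  (λ L separating → ≤-trans (tSeparating⇒hubSeparations {m} L separating) (total-≤ hub-maximal L))
  (orbit m ρ) (orbit-tSeparating {n} ρ hub≤rim) (begin
    length (orbit m ρ) * hubSeparations m ρ
      ≡⟨ cong (_* hubSeparations m ρ) (length-orbit m ρ) ⟩
    2 * (m ! * m !) * hubSeparations m ρ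
      ≡⟨ regroup m (suc n) (suc n !) (n !) (hubSeparations m ρ) ⟩
    2 * (m * pairs m) * (n ! * suc n ! * hubSeparations m ρ) ∎)
  where
  open ≡-Reasoning
  m : ℕ
  m = 2 + n
  instance
    multiplicity≢0 : NonZero (n ! * suc n ! * hubSeparations m ρ)
    multiplicity≢0 = m*n≢0 (n ! * suc n !) (hubSeparations m ρ) {{n !* suc n !≢0}}
  regroup : ∀ m k a b h → 2 * (m * a * (m * (k * b))) * h ≡ 2 * (m * (m * k)) * (b * a * h)
  regroup = solve-∀

balanced-maximal : ∀ m σ → hubSeparations m σ ≤ hubSeparations m (balanced m)
balanced-maximal m σ = +-cancelʳ-≤ (squareSum m) _ _
  (≤-trans (hubSeparations-≤ m σ) (≤-reflexive (sym (Balanced.hubSeparations-balanced m))))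

hubSeparations-balanced≢0 : ∀ n → NonZero (hubSeparations (2 + n) (balanced (2 + n)))
hubSeparations-balanced≢0 n = ≢-nonZero λ hub≡0 →
  1+n≢0 (trans (sym (hubSeparations-closed (suc n))) (cong (6 *_) hub≡0))

mainTheorem13 : (m : ℕ) → 2 ≤ m → FracSepDimIs m (targetValue m)
mainTheorem13 (suc zero)    (s≤s ())
mainTheorem13 (suc (suc n)) _ = subst (FracSepDimIs m) target
  (fracSepDim-K₁ₘₘ n (balanced m) (balanced-maximal m) (hubSeparations-≤-rimSeparations n))
  where
  m : ℕ
  m = 2 + n
  instance
    hub≢0 : NonZero (hubSeparations m (balanced m))
    hub≢0 = hubSeparations-balanced≢0 n
  target : ℤ.+ (2 * (m * pairs m)) / hubSeparations m (balanced m) ≡ targetValue m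
  target = /-cong-cross (2 * (m * pairs m)) (hubSeparations m (balanced m)) (24 * m * (2 * ⌈ m /2⌉ ∸ 1)) _
                        (target-cross-multiplied n)
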